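{- For any real $\alpha$ with $0<\alpha<\frac{3+\sqrt5}2$, no deterministic online algorithm (not necessarily monotone) for maximizing a non-negative monotone submodular function under a partition matroid constraint with free disposal, on instances of the form described in the context (all parts of capacity $1$), can have competitive ratio strictly larger than $\frac1\alpha$.
   Context: Instances: let $\mathcal{U}$ be a universe of items with weights $\nu:\mathcal{U}\to\mathbb{R}_+$, and $\nu(X):=\sum_{x\in X}\nu(x)$ for $X\subseteq\mathcal{U}$. For $i\ge0$ let $\Omega_i:=\{(u,i):u\in\mathcal{U}\}$ and let $\Omega:=\bigcup_{i\ge0}\Omega_i$. A (finite) set $S\subset\Omega$ is independent iff $|S\cap\Omega_i|\le1$ for all $i$ (a partition matroid with unit capacities). The objective is $f(S):=\nu(\{x:(x,i)\in S\text{ for some }i\})$, which is monotone submodular. Online problem with free disposal: distinct elements of $\Omega$ arrive one by one in a finite sequence whose length is unknown to the algorithm. The algorithm maintains an independent set $S$, initially empty. When $u$ arrives, it may remove elements from $S$ and may include $u$ in $S$, as long as $S$ remains independent; rejected or removed elements cannot be retrieved. The algorithm has a value oracle for $f$ and an independence oracle, only on sets of elements that have arrived so far, so the decisions of a deterministic algorithm are determined by this information. $\mathsf{OPT}$ is an independent set of elements of the sequence maximizing $f$. A deterministic algorithm has competitive ratio $r$ if for every instance and at the end of every finite sequence, $f(S)\ge r\cdot f(\mathsf{OPT})$. -}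

module Defs where

open import Data.Bool using (Bool; true; false; T)
open import Data.Fin using (Fin)
import Data.Fin.Properties as Fin
open import Data.Fin.Subset using (Subset; inside; outside; ∣_∣; _∩_; _⊆_)
import Data.Integer as ℤ
import Data.Integer.Properties as ℤ
open import Data.List using (List; foldr; deduplicate)
import Data.List as List
open import Data.Nat as ℕ using (ℕ; zero; suc; z≤n; s≤s)
import Data.Nat.Properties as ℕ
open import Data.Nat.Solver using (module +-*-Solver)
open import Data.Product using (∃-syntax; _×_; _,_; proj₁; proj₂)
open import Data.Rational as ℚ using (ℚ; mkℚ; 0ℚ; 1ℚ; ½)
import Data.Rational.Properties as ℚ
open import Data.Rational.Solver using () renaming (module +-*-Solver to ℚ-Solver)
open import Data.Rational.Unnormalised as ℚᵘ using (mkℚᵘ)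
import Data.Rational.Unnormalised.Properties as ℚᵘ
open import Data.Sum using (inj₁; inj₂)
open import Data.Unit using (tt)
open import Data.Vec as Vec using (Vec; []; _∷_; lookup)
open import Data.Vec.Relation.Unary.Unique.Propositional using (Unique)
open import Relation.Binary.Definitions using (DecidableEquality)
open import Relation.Binary.PropositionalEquality
open import Relation.Nullary using (¬_; Dec; yes; no; does; contradiction)
open import Relation.Nullary.Decidable using (map′)

------------------------------------------------------------------------
-- Real numbers, as Cauchy sequences of rationals

IsCauchy : (ℕ → ℚ) → Set
IsCauchy s = ∀ ε → 0ℚ ℚ.< ε →
  ∃[ N ] ∀ m n → N ℕ.≤ m → N ℕ.≤ n → ℚ.∣ s m ℚ.- s n ∣ ℚ.< ε

record ℝ : Set where
  constructor mkℝ
  field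
    seq    : ℕ → ℚ
    cauchy : IsCauchy seq

open ℝ public

infix 4 _<_ _≤_

-- The difference is eventually bounded below by a positive rational: a
-- pointwise strict inequality would not survive passing to the limit.
_<_ : ℝ → ℝ → Set
x < y = ∃[ ε ] 0ℚ ℚ.< ε × ∃[ N ] ∀ n → N ℕ.≤ n → seq x n ℚ.+ ε ℚ.≤ seq y n

_≤_ : ℝ → ℝ → Set
x ≤ y = ¬ (y < x)

private

  ∣∣-< : ∀ {p ε} → p ℚ.< ε → ℚ.- p ℚ.< ε → ℚ.∣ p ∣ ℚ.< ε
  ∣∣-< {p} a b with ℚ.∣p∣≡p∨∣p∣≡-p p
  ... | inj₁ eq = subst (ℚ._< _) (sym eq) a
  ... | inj₂ eq = subst (ℚ._< _) (sym eq) b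

  0<* : ∀ {p q} → 0ℚ ℚ.< p → 0ℚ ℚ.< q → 0ℚ ℚ.< p ℚ.* q
  0<* {p} {q} 0<p 0<q = ℚ.positive⁻¹ (p ℚ.* q) {{ℚ.pos*pos⇒pos p q}}
    where instance
      _ = ℚ.positive 0<p
      _ = ℚ.positive 0<q

  *½+*½ : ∀ ε → ε ℚ.* ½ ℚ.+ ε ℚ.* ½ ≡ ε
  *½+*½ ε = trans (sym (ℚ.*-distribˡ-+ ε ½ ½)) (ℚ.*-identityʳ ε)

  0<½ : 0ℚ ℚ.< ½
  0<½ = ℚ.positive⁻¹ ½

  cauchy-const : ∀ q → IsCauchy (λ _ → q)
  cauchy-const q ε 0<ε = 0 , λ _ _ _ _ →
    subst (ℚ._< ε) (sym (cong ℚ.∣_∣ (ℚ.+-inverseʳ q))) 0<ε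

  cauchy-+ : ∀ s t → IsCauchy s → IsCauchy t → IsCauchy (λ n → s n ℚ.+ t n)
  cauchy-+ s t cs ct ε 0<ε = M ℕ.⊔ N , bound
    where
    open ℚ-Solver using (solve; _:+_; _:-_; _:=_)
    ε½ = ε ℚ.* ½
    M = proj₁ (cs ε½ (0<* 0<ε 0<½))
    N = proj₁ (ct ε½ (0<* 0<ε 0<½))
    bound : ∀ m n → M ℕ.⊔ N ℕ.≤ m → M ℕ.⊔ N ℕ.≤ n →
            ℚ.∣ (s m ℚ.+ t m) ℚ.- (s n ℚ.+ t n) ∣ ℚ.< ε
    bound m n p q = begin-strict
      ℚ.∣ (s m ℚ.+ t m) ℚ.- (s n ℚ.+ t n) ∣
        ≡⟨ cong ℚ.∣_∣ (solve 4 (λ a b c d → (a :+ b) :- (c :+ d) := (a :- c) :+ (b :- d))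
                             refl (s m) (t m) (s n) (t n)) ⟩
      ℚ.∣ (s m ℚ.- s n) ℚ.+ (t m ℚ.- t n) ∣
        ≤⟨ ℚ.∣p+q∣≤∣p∣+∣q∣ (s m ℚ.- s n) (t m ℚ.- t n) ⟩
      ℚ.∣ s m ℚ.- s n ∣ ℚ.+ ℚ.∣ t m ℚ.- t n ∣
        <⟨ ℚ.+-mono-< (proj₂ (cs ε½ (0<* 0<ε 0<½)) m n (ℕ.m⊔n≤o⇒m≤o M N p) (ℕ.m⊔n≤o⇒m≤o M N q))
                      (proj₂ (ct ε½ (0<* 0<ε 0<½)) m n (ℕ.m⊔n≤o⇒n≤o M N p) (ℕ.m⊔n≤o⇒n≤o M N q)) ⟩
      ε½ ℚ.+ ε½
        ≡⟨ *½+*½ ε ⟩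
      ε ∎
      where open ℚ.≤-Reasoning

  eventually-bounded : ∀ s → IsCauchy s →
    ∃[ N ] ∃[ B ] 0ℚ ℚ.< B × ∀ n → N ℕ.≤ n → ℚ.∣ s n ∣ ℚ.≤ B
  eventually-bounded s cs with cs 1ℚ (ℚ.positive⁻¹ 1ℚ)
  ... | N , close = N , 1ℚ ℚ.+ ℚ.∣ s N ∣ , 0<B , bound
    where
    open ℚ-Solver using (solve; _:+_; _:-_; _:=_)
    open ℚ.≤-Reasoning
    0<B : 0ℚ ℚ.< 1ℚ ℚ.+ ℚ.∣ s N ∣
    0<B = ℚ.+-mono-<-≤ (ℚ.positive⁻¹ 1ℚ) (ℚ.0≤∣p∣ (s N))
    bound : ∀ n → N ℕ.≤ n → ℚ.∣ s n ∣ ℚ.≤ 1ℚ ℚ.+ ℚ.∣ s N ∣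
    bound n N≤n = begin
      ℚ.∣ s n ∣
        ≡⟨ cong ℚ.∣_∣ (solve 2 (λ a b → a := (a :- b) :+ b) refl (s n) (s N)) ⟩
      ℚ.∣ (s n ℚ.- s N) ℚ.+ s N ∣
        ≤⟨ ℚ.∣p+q∣≤∣p∣+∣q∣ (s n ℚ.- s N) (s N) ⟩
      ℚ.∣ s n ℚ.- s N ∣ ℚ.+ ℚ.∣ s N ∣
        ≤⟨ ℚ.+-monoˡ-≤ ℚ.∣ s N ∣ (ℚ.<⇒≤ (close n N N≤n ℕ.≤-refl)) ⟩
      1ℚ ℚ.+ ℚ.∣ s N ∣ ∎

-- The reciprocal of max(q, δ), hence of q itself as soon as δ ≤ q.
recip : ∀ δ → 0ℚ ℚ.< δ → ℚ → ℚ
recip δ 0<δ q = (ℚ.1/ (q ℚ.⊔ δ)) {{ℚ.>-nonZero (ℚ.<-≤-trans 0<δ (ℚ.p≤q⊔p q δ))}}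

module _ (δ : ℚ) (0<δ : 0ℚ ℚ.< δ) where
  private
    r : ℚ → ℚ
    r = recip δ 0<δ

  recip-inverse : ∀ q → δ ℚ.≤ q → q ℚ.* r q ≡ 1ℚ
  recip-inverse q δ≤q = trans (cong (ℚ._* r q) (sym (ℚ.p≥q⇒p⊔q≡p δ≤q)))
    (ℚ.*-inverseʳ (q ℚ.⊔ δ) {{ℚ.>-nonZero (ℚ.<-≤-trans 0<δ (ℚ.p≤q⊔p q δ))}})

  0<recip : ∀ q → 0ℚ ℚ.< r q
  0<recip q = ℚ.positive⁻¹ (r q) {{ℚ.1/pos⇒pos (q ℚ.⊔ δ) {{ℚ.positive (ℚ.<-≤-trans 0<δ (ℚ.p≤q⊔p q δ))}}}}

  recip-≤ : ∀ q → δ ℚ.≤ q → r q ℚ.≤ r δ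
  recip-≤ q δ≤q = begin
    r q
      ≡⟨ ℚ.*-identityʳ (r q) ⟨
    r q ℚ.* 1ℚ
      ≡⟨ cong (r q ℚ.*_) (recip-inverse δ ℚ.≤-refl) ⟨
    r q ℚ.* (δ ℚ.* r δ)
      ≤⟨ ℚ.*-monoˡ-≤-nonNeg (r q) {{nn q}} (ℚ.*-monoʳ-≤-nonNeg (r δ) {{nn δ}} δ≤q) ⟩
    r q ℚ.* (q ℚ.* r δ)
      ≡⟨ solve 3 (λ a b c → a :* (b :* c) := (b :* a) :* c) refl (r q) q (r δ) ⟩
    (q ℚ.* r q) ℚ.* r δ
      ≡⟨ cong (ℚ._* r δ) (recip-inverse q δ≤q) ⟩
    1ℚ ℚ.* r δ
      ≡⟨ ℚ.*-identityˡ (r δ) ⟩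
    r δ ∎
    where
    open ℚ.≤-Reasoning
    open ℚ-Solver using (solve; _:*_; _:=_)
    nn : ∀ q → ℚ.NonNegative (r q)
    nn q = ℚ.nonNegative (ℚ.<⇒≤ (0<recip q))

private

  ∣*∣-mono : ∀ p q {p′ q′} → ℚ.∣ p ∣ ℚ.≤ p′ → ℚ.∣ q ∣ ℚ.≤ q′ → ℚ.∣ p ℚ.* q ∣ ℚ.≤ p′ ℚ.* q′
  ∣*∣-mono p q {p′} {q′} p≤ q≤ = begin
    ℚ.∣ p ℚ.* q ∣          ≡⟨ ℚ.∣p*q∣≡∣p∣*∣q∣ p q ⟩
    ℚ.∣ p ∣ ℚ.* ℚ.∣ q ∣    ≤⟨ ℚ.*-monoˡ-≤-nonNeg ℚ.∣ p ∣ {{ℚ.∣-∣-nonNeg p}} q≤ ⟩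
    ℚ.∣ p ∣ ℚ.* q′         ≤⟨ ℚ.*-monoʳ-≤-nonNeg q′ {{ℚ.nonNegative (ℚ.≤-trans (ℚ.0≤∣p∣ q) q≤)}} p≤ ⟩
    p′ ℚ.* q′ ∎
    where open ℚ.≤-Reasoning

  cauchy-* : ∀ s t → IsCauchy s → IsCauchy t → IsCauchy (λ n → s n ℚ.* t n)
  cauchy-* s t cs ct ε 0<ε = K , bound
    where
    open ℚ-Solver using (solve; _:+_; _:-_; _:*_; _:=_)
    bs = eventually-bounded s cs
    bt = eventually-bounded t ct
    B = proj₁ (proj₂ bs)
    C = proj₁ (proj₂ bt)
    D = B ℚ.+ C
    0<D : 0ℚ ℚ.< D
    0<D = ℚ.+-mono-< (proj₁ (proj₂ (proj₂ bs))) (proj₁ (proj₂ (proj₂ bt)))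
    η = (ε ℚ.* ½) ℚ.* recip D 0<D D
    0<η : 0ℚ ℚ.< η
    0<η = 0<* (0<* 0<ε 0<½) (0<recip D 0<D D)
    K₁ = proj₁ bs ℕ.⊔ proj₁ bt
    K₂ = proj₁ (cs η 0<η) ℕ.⊔ proj₁ (ct η 0<η)
    K = K₁ ℕ.⊔ K₂
    bound : ∀ m n → K ℕ.≤ m → K ℕ.≤ n → ℚ.∣ s m ℚ.* t m ℚ.- s n ℚ.* t n ∣ ℚ.< ε
    bound m n p q = begin-strict
      ℚ.∣ s m ℚ.* t m ℚ.- s n ℚ.* t n ∣
        ≡⟨ cong ℚ.∣_∣ (solve 4 (λ a b c d → a :* b :- c :* d := a :* (b :- d) :+ (a :- c) :* d)
                             refl (s m) (t m) (s n) (t n)) ⟩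
      ℚ.∣ s m ℚ.* (t m ℚ.- t n) ℚ.+ (s m ℚ.- s n) ℚ.* t n ∣
        ≤⟨ ℚ.∣p+q∣≤∣p∣+∣q∣ (s m ℚ.* (t m ℚ.- t n)) ((s m ℚ.- s n) ℚ.* t n) ⟩
      ℚ.∣ s m ℚ.* (t m ℚ.- t n) ∣ ℚ.+ ℚ.∣ (s m ℚ.- s n) ℚ.* t n ∣
        ≤⟨ ℚ.+-mono-≤
             (∣*∣-mono (s m) (t m ℚ.- t n) (proj₂ (proj₂ (proj₂ bs)) m (ℕ.m⊔n≤o⇒m≤o (proj₁ bs) (proj₁ bt) (ℕ.m⊔n≤o⇒m≤o K₁ K₂ p)))
                       (ℚ.<⇒≤ (proj₂ (ct η 0<η) m n (ℕ.m⊔n≤o⇒n≤o (proj₁ (cs η 0<η)) (proj₁ (ct η 0<η)) (ℕ.m⊔n≤o⇒n≤o K₁ K₂ p))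
                                                    (ℕ.m⊔n≤o⇒n≤o (proj₁ (cs η 0<η)) (proj₁ (ct η 0<η)) (ℕ.m⊔n≤o⇒n≤o K₁ K₂ q)))))
             (∣*∣-mono (s m ℚ.- s n) (t n) (ℚ.<⇒≤ (proj₂ (cs η 0<η) m n (ℕ.m⊔n≤o⇒m≤o (proj₁ (cs η 0<η)) (proj₁ (ct η 0<η)) (ℕ.m⊔n≤o⇒n≤o K₁ K₂ p))
                                                    (ℕ.m⊔n≤o⇒m≤o (proj₁ (cs η 0<η)) (proj₁ (ct η 0<η)) (ℕ.m⊔n≤o⇒n≤o K₁ K₂ q))))
                       (proj₂ (proj₂ (proj₂ bt)) n (ℕ.m⊔n≤o⇒n≤o (proj₁ bs) (proj₁ bt) (ℕ.m⊔n≤o⇒m≤o K₁ K₂ q)))) ⟩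
      B ℚ.* η ℚ.+ η ℚ.* C
        ≡⟨ solve 4 (λ b c e r → b :* (e :* r) :+ (e :* r) :* c := e :* ((b :+ c) :* r))
                 refl B C (ε ℚ.* ½) (recip D 0<D D) ⟩
      (ε ℚ.* ½) ℚ.* (D ℚ.* recip D 0<D D)
        ≡⟨ cong ((ε ℚ.* ½) ℚ.*_) (recip-inverse D 0<D D ℚ.≤-refl) ⟩
      (ε ℚ.* ½) ℚ.* 1ℚ
        ≡⟨ ℚ.*-identityʳ (ε ℚ.* ½) ⟩
      ε ℚ.* ½
        <⟨ ℚ.*-monoʳ-<-pos ε {{ℚ.positive 0<ε}} (ℚ.*<* (ℤ.+<+ (s≤s (s≤s z≤n)))) ⟩
      ε ℚ.* 1ℚ
        ≡⟨ ℚ.*-identityʳ ε ⟩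
      ε ∎
      where open ℚ.≤-Reasoning

  cauchy-recip : ∀ s δ (0<δ : 0ℚ ℚ.< δ) → (∃[ N ] ∀ n → N ℕ.≤ n → δ ℚ.≤ s n) →
                 IsCauchy s → IsCauchy (λ n → recip δ 0<δ (s n))
  cauchy-recip s δ 0<δ (M , δ≤) cs ε 0<ε = M ℕ.⊔ N , bound
    where
    open ℚ-Solver using (solve; _:-_; _:*_; _:=_)
    r = recip δ 0<δ
    η = ε ℚ.* (δ ℚ.* δ)
    0<η : 0ℚ ℚ.< η
    0<η = 0<* 0<ε (0<* 0<δ 0<δ)
    N = proj₁ (cs η 0<η)
    ∣r∣≤ : ∀ n → M ℕ.≤ n → ℚ.∣ r (s n) ∣ ℚ.≤ r δ
    ∣r∣≤ n M≤n = subst (ℚ._≤ r δ) (sym (ℚ.0≤p⇒∣p∣≡p (ℚ.<⇒≤ (0<recip δ 0<δ (s n)))))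
                       (recip-≤ δ 0<δ (s n) (δ≤ n M≤n))
    rδ² : 0ℚ ℚ.< r δ ℚ.* r δ
    rδ² = 0<* (0<recip δ 0<δ δ) (0<recip δ 0<δ δ)
    bound : ∀ m n → M ℕ.⊔ N ℕ.≤ m → M ℕ.⊔ N ℕ.≤ n → ℚ.∣ r (s m) ℚ.- r (s n) ∣ ℚ.< ε
    bound m n p q = begin-strict
      ℚ.∣ r a ℚ.- r b ∣
        ≡⟨ cong ℚ.∣_∣ (cong₂ ℚ._-_ (ℚ.*-identityʳ (r a)) (ℚ.*-identityʳ (r b))) ⟨
      ℚ.∣ r a ℚ.* 1ℚ ℚ.- r b ℚ.* 1ℚ ∣
        ≡⟨ cong ℚ.∣_∣ (cong₂ (λ u v → r a ℚ.* u ℚ.- r b ℚ.* v)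
             (recip-inverse δ 0<δ b (δ≤ n (ℕ.m⊔n≤o⇒m≤o M N q)))
             (recip-inverse δ 0<δ a (δ≤ m (ℕ.m⊔n≤o⇒m≤o M N p)))) ⟨
      ℚ.∣ r a ℚ.* (b ℚ.* r b) ℚ.- r b ℚ.* (a ℚ.* r a) ∣
        ≡⟨ cong ℚ.∣_∣ (solve 4 (λ a b u v → u :* (b :* v) :- v :* (a :* u) := (b :- a) :* (u :* v))
                             refl a b (r a) (r b)) ⟩
      ℚ.∣ (b ℚ.- a) ℚ.* (r a ℚ.* r b) ∣
        ≤⟨ ∣*∣-mono (b ℚ.- a) (r a ℚ.* r b) ℚ.≤-refl (∣*∣-mono (r a) (r b) (∣r∣≤ m (ℕ.m⊔n≤o⇒m≤o M N p)) (∣r∣≤ n (ℕ.m⊔n≤o⇒m≤o M N q))) ⟩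
      ℚ.∣ b ℚ.- a ∣ ℚ.* (r δ ℚ.* r δ)
        <⟨ ℚ.*-monoˡ-<-pos (r δ ℚ.* r δ) {{ℚ.positive rδ²}}
             (proj₂ (cs η 0<η) n m (ℕ.m⊔n≤o⇒n≤o M N q) (ℕ.m⊔n≤o⇒n≤o M N p)) ⟩
      η ℚ.* (r δ ℚ.* r δ)
        ≡⟨ solve 3 (λ e d u → (e :* (d :* d)) :* (u :* u) := e :* ((d :* u) :* (d :* u)))
                 refl ε δ (r δ) ⟩
      ε ℚ.* ((δ ℚ.* r δ) ℚ.* (δ ℚ.* r δ))
        ≡⟨ cong (λ u → ε ℚ.* (u ℚ.* u)) (recip-inverse δ 0<δ δ ℚ.≤-refl) ⟩
      ε ℚ.* (1ℚ ℚ.* 1ℚ)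
        ≡⟨ ℚ.*-identityʳ ε ⟩
      ε ∎
      where
      open ℚ.≤-Reasoning
      a = s m
      b = s n

-- Abstract, as the proofs are large and never needed in normal form.
abstract

  const-isCauchy : ∀ q → IsCauchy (λ _ → q)
  const-isCauchy = cauchy-const

  +-isCauchy : ∀ x y → IsCauchy (λ n → seq x n ℚ.+ seq y n)
  +-isCauchy x y = cauchy-+ (seq x) (seq y) (cauchy x) (cauchy y)

  *-isCauchy : ∀ x y → IsCauchy (λ n → seq x n ℚ.* seq y n)
  *-isCauchy x y = cauchy-* (seq x) (seq y) (cauchy x) (cauchy y)

  recip-isCauchy : ∀ x δ (0<δ : 0ℚ ℚ.< δ) → (∃[ N ] ∀ n → N ℕ.≤ n → δ ℚ.≤ seq x n) →
                   IsCauchy (λ n → recip δ 0<δ (seq x n))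
  recip-isCauchy x δ 0<δ δ≤ = cauchy-recip (seq x) δ 0<δ δ≤ (cauchy x)

fromℚ : ℚ → ℝ
fromℚ q = mkℝ (λ _ → q) (const-isCauchy q)

0ℝ : ℝ
0ℝ = fromℚ 0ℚ

infixl 6 _+_
infixl 7 _*_
infix 8 _⁻¹⟨_⟩

_+_ : ℝ → ℝ → ℝ
x + y = mkℝ (λ n → seq x n ℚ.+ seq y n) (+-isCauchy x y)

_*_ : ℝ → ℝ → ℝ
x * y = mkℝ (λ n → seq x n ℚ.* seq y n) (*-isCauchy x y)

-- From the index N of the witness on, ε ≤ seq x n, so the n-th term is
-- 1 / seq x n; truncation at ε only affects the terms before that.
_⁻¹⟨_⟩ : (x : ℝ) → 0ℝ < x → ℝ
x ⁻¹⟨ ε , 0<ε , N , 0+ε≤ ⟩ = mkℝ (λ n → recip ε 0<ε (seq x n))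
  (recip-isCauchy x ε 0<ε
    (N , λ n N≤n → subst (ℚ._≤ seq x n) (ℚ.+-identityˡ ε) (0+ε≤ n N≤n)))

------------------------------------------------------------------------
-- Square roots of natural numbers

floorSqrt : ℕ → ℕ
floorSqrt zero    = zero
floorSqrt (suc k) = step (floorSqrt k)
  module FloorSqrt where
  step : ℕ → ℕ
  step m with suc m ℕ.* suc m ℕ.≤? suc k
  ... | yes _ = suc m
  ... | no  _ = m

floorSqrt-lower : ∀ k → floorSqrt k ℕ.* floorSqrt k ℕ.≤ k
floorSqrt-lower zero    = z≤n
floorSqrt-lower (suc k) with suc (floorSqrt k) ℕ.* suc (floorSqrt k) ℕ.≤? suc k
... | yes p = p
... | no  _ = ℕ.m≤n⇒m≤1+n (floorSqrt-lower k)

floorSqrt-upper : ∀ k → k ℕ.< suc (floorSqrt k) ℕ.* suc (floorSqrt k)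
floorSqrt-upper zero    = s≤s z≤n
floorSqrt-upper (suc k) with suc (floorSqrt k) ℕ.* suc (floorSqrt k) ℕ.≤? suc k
... | yes _ = ℕ.≤-<-trans (floorSqrt-upper k)
                (ℕ.*-mono-< (ℕ.n<1+n (suc (floorSqrt k))) (ℕ.n<1+n (suc (floorSqrt k))))
... | no ¬p = ℕ.≰⇒> ¬p

sqrtApprox : ℕ → ℕ → ℚ
sqrtApprox k n = ℤ.+ floorSqrt (k ℕ.* (suc n ℕ.* suc n)) ℚ./ suc n

private

  toℚᵘ-/ : ∀ i n → ℚ.toℚᵘ (i ℚ./ suc n) ℚᵘ.≃ mkℚᵘ i n
  toℚᵘ-/ i n = ℚ.toℚᵘ-fromℚᵘ (mkℚᵘ i n)

  /-< : ∀ p m q n → p ℕ.* suc n ℕ.< q ℕ.* suc m → (ℤ.+ p) ℚ./ suc m ℚ.< (ℤ.+ q) ℚ./ suc n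
  /-< p m q n lt = ℚ.toℚᵘ-cancel-<
    (ℚᵘ.<-respˡ-≃ (ℚᵘ.≃-sym (toℚᵘ-/ (ℤ.+ p) m))
      (ℚᵘ.<-respʳ-≃ (ℚᵘ.≃-sym (toℚᵘ-/ (ℤ.+ q) n))
        (ℚᵘ.*<* (subst₂ ℤ._<_ (ℤ.pos-* p (suc n)) (ℤ.pos-* q (suc m)) (ℤ.+<+ lt)))))

  suc-/ : ∀ q n → (ℤ.+ suc q) ℚ./ suc n ≡ (ℤ.+ q) ℚ./ suc n ℚ.+ (ℤ.+ 1) ℚ./ suc n
  suc-/ q n = ℚ.toℚᵘ-injective (begin
    ℚ.toℚᵘ ((ℤ.+ suc q) ℚ./ suc n)
      ≈⟨ toℚᵘ-/ (ℤ.+ suc q) n ⟩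
    mkℚᵘ (ℤ.+ suc q) n
      ≈⟨ ℚᵘ.*≡* lemma ⟩
    mkℚᵘ (ℤ.+ q) n ℚᵘ.+ mkℚᵘ (ℤ.+ 1) n
      ≈⟨ ℚᵘ.+-cong (toℚᵘ-/ (ℤ.+ q) n) (toℚᵘ-/ (ℤ.+ 1) n) ⟨
    ℚ.toℚᵘ ((ℤ.+ q) ℚ./ suc n) ℚᵘ.+ ℚ.toℚᵘ ((ℤ.+ 1) ℚ./ suc n)
      ≈⟨ ℚ.toℚᵘ-homo-+ ((ℤ.+ q) ℚ./ suc n) ((ℤ.+ 1) ℚ./ suc n) ⟨
    ℚ.toℚᵘ ((ℤ.+ q) ℚ./ suc n ℚ.+ (ℤ.+ 1) ℚ./ suc n) ∎)
    where
    open import Relation.Binary.Reasoning.Setoid ℚᵘ.≃-setoid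
    open import Data.Integer.Solver using () renaming (module +-*-Solver to ℤ-Solver)
    open ℤ-Solver using (solve; _:+_; _:*_; _:=_; con)
    lemma : ℤ.+ suc q ℤ.* (ℤ.+ suc n ℤ.* ℤ.+ suc n) ≡
            (ℤ.+ q ℤ.* ℤ.+ suc n ℤ.+ ℤ.+ 1 ℤ.* ℤ.+ suc n) ℤ.* ℤ.+ suc n
    lemma = solve 2 (λ a b → (con (ℤ.+ 1) :+ a) :* (b :* b) :=
                             (a :* b :+ con (ℤ.+ 1) :* b) :* b) refl (ℤ.+ q) (ℤ.+ suc n)

  square-cancel-< : ∀ a b → a ℕ.* a ℕ.< b ℕ.* b → a ℕ.< b
  square-cancel-< a b lt with b ℕ.≤? a
  ... | yes b≤a = contradiction (ℕ.*-mono-≤ b≤a b≤a) (ℕ.<⇒≱ lt)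
  ... | no  b≰a = ℕ.≰⇒> b≰a

  sqrtApprox-< : ∀ k m n → sqrtApprox k m ℚ.< sqrtApprox k n ℚ.+ (ℤ.+ 1) ℚ./ suc n
  sqrtApprox-< k m n = subst (sqrtApprox k m ℚ.<_) (suc-/ q n)
    (/-< p m (suc q) n (square-cancel-< _ _ squares))
    where
    open +-*-Solver using (solve; _:*_; _:=_)
    open ℕ.≤-Reasoning
    M = suc m
    N = suc n
    p = floorSqrt (k ℕ.* (M ℕ.* M))
    q = floorSqrt (k ℕ.* (N ℕ.* N))
    squares : (p ℕ.* N) ℕ.* (p ℕ.* N) ℕ.< (suc q ℕ.* M) ℕ.* (suc q ℕ.* M)
    squares = begin-strict
      (p ℕ.* N) ℕ.* (p ℕ.* N)
        ≡⟨ solve 2 (λ a b → (a :* b) :* (a :* b) := (a :* a) :* (b :* b)) refl p N ⟩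
      (p ℕ.* p) ℕ.* (N ℕ.* N)
        ≤⟨ ℕ.*-monoˡ-≤ (N ℕ.* N) (floorSqrt-lower (k ℕ.* (M ℕ.* M))) ⟩
      (k ℕ.* (M ℕ.* M)) ℕ.* (N ℕ.* N)
        ≡⟨ solve 3 (λ c a b → (c :* (a :* a)) :* (b :* b) := (c :* (b :* b)) :* (a :* a)) refl k M N ⟩
      (k ℕ.* (N ℕ.* N)) ℕ.* (M ℕ.* M)
        <⟨ ℕ.*-monoˡ-< (M ℕ.* M) (floorSqrt-upper (k ℕ.* (N ℕ.* N))) ⟩
      (suc q ℕ.* suc q) ℕ.* (M ℕ.* M)
        ≡⟨ solve 2 (λ a b → (a :* a) :* (b :* b) := (a :* b) :* (a :* b)) refl (suc q) M ⟩
      (suc q ℕ.* M) ℕ.* (suc q ℕ.* M) ∎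

  1/-small : ∀ ε → 0ℚ ℚ.< ε → ∃[ N ] ∀ n → N ℕ.≤ n → (ℤ.+ 1) ℚ./ suc n ℚ.< ε
  1/-small ε@(mkℚ (ℤ.+ zero) d c) (ℚ.*<* (ℤ.+<+ ()))
  1/-small ε@(mkℚ ℤ.-[1+ a ] d c) (ℚ.*<* ())
  1/-small ε@(mkℚ (ℤ.+ suc a) d c) _ = suc d , λ n d<n →
    subst ((ℤ.+ 1) ℚ./ suc n ℚ.<_) (ℚ.↥p/↧p≡p ε)
      (/-< 1 n (suc a) d (begin-strict
        1 ℕ.* suc d       ≡⟨ ℕ.*-identityˡ (suc d) ⟩
        suc d             <⟨ s≤s d<n ⟩
        suc n             ≤⟨ ℕ.m≤m+n (suc n) (a ℕ.* suc n) ⟩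
        suc a ℕ.* suc n ∎))
    where open ℕ.≤-Reasoning

  cauchy-sqrt : ∀ k → IsCauchy (sqrtApprox k)
  cauchy-sqrt k ε 0<ε with 1/-small ε 0<ε
  ... | N , small = N , λ m n N≤m N≤n → ∣∣-< (diff m n (small n N≤n))
          (subst (ℚ._< ε) (solve 2 (λ a b → b :- a := :- (a :- b)) refl (s m) (s n))
            (diff n m (small m N≤m)))
    where
    open ℚ-Solver using (solve; _:+_; _:-_; :-_; _:=_)
    s = sqrtApprox k
    diff : ∀ m n → (ℤ.+ 1) ℚ./ suc n ℚ.< ε → s m ℚ.- s n ℚ.< ε
    diff m n lt = ℚ.<-trans
      (subst (s m ℚ.- s n ℚ.<_)
        (solve 2 (λ a b → (a :+ b) :- a := b) refl (s n) ((ℤ.+ 1) ℚ./ suc n))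
        (ℚ.+-monoˡ-< (ℚ.- s n) (sqrtApprox-< k m n)))
      lt

abstract

  sqrtApprox-isCauchy : ∀ k → IsCauchy (sqrtApprox k)
  sqrtApprox-isCauchy = cauchy-sqrt

-- The n-th term ⌊(n+1)√k⌋ / (n+1) is within 1/(n+1) of √k.
√ : ℕ → ℝ
√ k = mkℝ (sqrtApprox k) (sqrtApprox-isCauchy k)

3ℚ : ℚ
3ℚ = ℤ.+ 3 ℚ./ 1

------------------------------------------------------------------------
-- Instances

record Instance : Set₁ where
  field
    𝒰   : Set
    _≟_ : DecidableEquality 𝒰
    ν   : 𝒰 → ℝ
    ν≥0 : ∀ u → 0ℝ ≤ ν u

  Ω : Set
  Ω = 𝒰 × ℕ

  -- ν(X), where the list enumerates X possibly with repetitions.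
  weight : List 𝒰 → ℝ
  weight xs = foldr (λ x w → ν x + w) 0ℝ (deduplicate _≟_ xs)

-- A sequence of n arrivals is a vector whose head is the latest arrival.
-- Sets of arrived elements are subsets of its index set, so the elements
-- are known by their time of arrival alone.

select : ∀ {A : Set} {n} → Vec A n → Subset n → List A
select []       []            = List.[]
select (e ∷ es) (inside  ∷ S) = e List.∷ select es S
select (e ∷ es) (outside ∷ S) = select es S

module _ {U : Set} where

  part : ∀ {n} → Vec (U × ℕ) n → ℕ → Subset n
  part es i = Vec.map (λ e → does (proj₂ e ℕ.≟ i)) es

  Independent : ∀ {n} → Vec (U × ℕ) n → Subset n → Set
  Independent es S = ∀ i → ∣ S ∩ part es i ∣ ℕ.≤ 1

  private

    -- A nonempty part is the part of one of the arrivals.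
    part-level : ∀ {n} (es : Vec (U × ℕ) n) S i → 1 ℕ.≤ ∣ S ∩ part es i ∣ →
                 ∃[ k ] proj₂ (lookup es k) ≡ i
    part-level [] [] i ()
    part-level (e ∷ es) (outside ∷ S) i p with part-level es S i p
    ... | k , eq = Fin.suc k , eq
    part-level (e ∷ es) (inside ∷ S) i p with proj₂ e ℕ.≡ᵇ i in eq
    ... | true  = Fin.zero , ℕ.≡ᵇ⇒≡ (proj₂ e) i (subst T (sym eq) tt)
    ... | false with part-level es S i p
    ...   | k , eq′ = Fin.suc k , eq′

  independent? : ∀ {n} (es : Vec (U × ℕ) n) S → Dec (Independent es S)
  independent? es S = map′ to (λ ind k → ind _)
    (Fin.all? (λ k → ∣ S ∩ part es (proj₂ (lookup es k)) ∣ ℕ.≤? 1))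
    where
    to : (∀ k → ∣ S ∩ part es (proj₂ (lookup es k)) ∣ ℕ.≤ 1) → Independent es S
    to h i with ∣ S ∩ part es i ∣ ℕ.≤? 1
    ... | yes p = p
    ... | no ¬p with part-level es S i (ℕ.<⇒≤ (ℕ.≰⇒> ¬p))
    ...   | k , refl = h k

module _ (I : Instance) where
  open Instance I

  f : ∀ {n} → Vec Ω n → Subset n → ℝ
  f es S = weight (List.map proj₁ (select es S))

  IsOPT : ∀ {n} → Vec Ω n → Subset n → Set
  IsOPT es O = Independent es O × (∀ S → Independent es S → f es S ≤ f es O)

------------------------------------------------------------------------
-- Deterministic online algorithms

-- The new solution, as a function of the value oracle and the independence
-- oracle on the sets of arrived elements (the new one included) and of the
-- current solution. Earlier oracles are the restrictions of the present ones
-- to sets whose later entries are outside, so the whole history is available.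
-- Dependence on the Cauchy sequences representing the values is not excluded.
Policy : Set
Policy = ∀ {n} → (Subset (suc n) → ℝ) → (Subset (suc n) → Bool) → Subset n → Subset (suc n)

run : Policy → (I : Instance) → ∀ {n} → Vec (Instance.Ω I) n → Subset n
run P I []       = []
run P I (e ∷ es) = P (f I (e ∷ es)) (λ S → does (independent? (e ∷ es) S)) (run P I es)

record OnlineAlgorithm : Set₁ where
  field
    policy       : Policy
    irrevocable  : ∀ I {n} (e : Instance.Ω I) (es : Vec (Instance.Ω I) n) → Unique (e ∷ es) →
                   run policy I (e ∷ es) ⊆ inside ∷ run policy I es
    independent  : ∀ I {n} (es : Vec (Instance.Ω I) n) → Unique es →
                   Independent es (run policy I es)

open OnlineAlgorithm public

HasCompetitiveRatio : OnlineAlgorithm → ℝ → Set₁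
HasCompetitiveRatio A r =
  ∀ I {n} (es : Vec (Instance.Ω I) n) → Unique es →
  ∀ O → IsOPT I es O → r * f I es O ≤ f I es (run (policy A) I es)

{-# OPTIONS --safe #-}
module Submission where

-- Write β = α - 1. Since 1 + φ = (3 + √5)/2 for the golden ratio φ, the
-- hypothesis says β < φ. Taking c = M/D just below φ - 1 = 1/φ gives
-- c² + c ≤ 1 and β ≤ B/D, where B/D = 1 + c - 1/D (calibrate).
--
-- The adversary keeps track of a set G of items that contains all those the
-- policy may still hold, and of a set L of lost elements, of different items
-- and in different parts, whose items the policy can no longer hold. Copying
-- each item of G to a fresh part gains the policy nothing but lets the
-- optimum collect both L and G, so a policy with ratio better than 1/α has
-- weight(L) ≤ (B/D) weight(G) throughout (settle). The adversary plays
-- rounds until this fails.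
--
-- At the start of a round, what the policy holds is at most one element of a
-- main item, in a part p avoided by L, and side items of earlier rounds.
--
--  * A twin of the main item, of the same weight x, arrives in p. One of the
--    two is lost; call the other one a.
--  * A copy of a arrives in a fresh part q. A policy holding both copies
--    could trade one of them for the next main item at no cost. To prevent
--    that, side items of weights 1, 2, 3, ... arrive in q. If the policy
--    rejects all of them, up to a cap, then the lost twin in p and the last
--    side item in q make L too heavy (reject-all).
--  * Once a side item is accepted it occupies q, and a is held in p only.
--    The next main item, of weight x′, now arrives in p. If it is rejected,
--    then it and the last rejected side item make L too heavy (reject-next).
--    If it is accepted, a is lost, and since a copy of it arrived in q, the
--    optimum can take it there: the part of the new main item is again
--    avoided by L.
--
-- If x doubles in every round, the caps are c x, α and c are at their limits
-- and every side item is accepted at its cap, then up to the unit steps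
-- between side items both inequalities are equalities in all rounds: the
-- process is stationary. The weights
--
--   x = D 2ᵏ (K - k),   cap = M 2ᵏ (K - k - 2)   in round k, with K = 2D + 1,
--
-- drift away from this stationary solution, at a rate small enough for the
-- margins in the choice of c. In round K - 2 the cap is zero, so reject-all
-- applies at once.

import Defs
open import Defs hiding (_≤_; _<_; _+_; _*_)
open import Data.Bool using (true; false; T)
open import Data.Empty using (⊥; ⊥-elim)
open import Data.Fin.Subset using (Subset; inside; outside; ∣_∣; _∩_; _⊆_)
import Data.Fin.Subset.Properties as Subset
import Data.Integer as ℤ
import Data.Integer.Properties as ℤ
open import Data.List using (List; []; _∷_; _++_; map; deduplicate; foldr)
import Data.List.Membership.DecPropositional as DecMembership
open import Data.List.Membership.Propositional using (_∈_; _∉_)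
open import Data.List.Membership.Propositional.Properties
open import Data.List.Relation.Binary.Sublist.Propositional using ([]; _∷_; _∷ʳ_) renaming (_⊆_ to _⊑_; ⊆-refl to ⊑-refl)
import Data.List.Relation.Binary.Sublist.Propositional as Sublist
open import Data.List.Relation.Binary.Sublist.Propositional.Properties using (All-resp-⊆; ++⁺ˡ; ++⁺)
open import Data.List.Relation.Unary.All as All using (All; []; _∷_)
import Data.List.Relation.Unary.All.Properties as All
open import Data.List.Relation.Unary.AllPairs as AllPairs using (AllPairs; []; _∷_)
import Data.List.Relation.Unary.AllPairs.Properties as AllPairs
open import Data.List.Relation.Unary.Any using (here; there)
open import Data.List.Relation.Unary.Unique.DecPropositional.Properties using (deduplicate-!)
open import Data.List.Relation.Unary.Unique.Propositional using () renaming (Unique to UniqueList)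
open import Data.Nat as ℕ using (ℕ; zero; suc; _⊔_; z≤n; s≤s)
open import Data.Nat.ListAction using (sum)
import Data.Nat.Properties as ℕ
open import Data.Nat.Tactic.RingSolver using (solve-∀)
open import Data.Product using (∃-syntax; _×_; _,_; proj₁; proj₂; map₂)
open import Data.Product.Properties using (≡-dec)
open import Data.Rational as ℚ using (ℚ; mkℚ; 0ℚ; 1ℚ; ½)
open import Data.Rational.Literals using (fromℤ)
import Data.Rational.Properties as ℚ
open import Data.Rational.Solver using () renaming (module +-*-Solver to ℚ-Solver)
open import Data.Rational.Unnormalised using (mkℚᵘ)
import Data.Rational.Unnormalised as ℚᵘ
import Data.Rational.Unnormalised.Properties as ℚᵘ
open import Data.Sum as Sum using (_⊎_; inj₁; inj₂; [_,_]′)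
open import Data.Unit using (tt)
open import Data.Vec as Vec using (Vec; []; _∷_)
open import Data.Vec.Membership.Propositional using () renaming (_∈_ to _∈ᵛ_)
import Data.Vec.Relation.Unary.All as VecAll
open import Data.Vec.Relation.Unary.AllPairs using ([]; _∷_)
open import Data.Vec.Relation.Unary.Any using (here; there)
open import Data.Vec.Relation.Unary.Unique.Propositional using (Unique)
open import Function using (_∘_; id)
open import Relation.Binary.Definitions using (DecidableEquality)
open import Relation.Binary.PropositionalEquality
open import Relation.Nullary using (¬_; Dec; yes; no; does; contradiction)

-- Natural numbers as rationals

fromℕ : ℕ → ℚ
fromℕ n = fromℤ (ℤ.+ n)

fromℕ-+ : ∀ m n → fromℕ (m ℕ.+ n) ≡ fromℕ m ℚ.+ fromℕ n
fromℕ-+ m n = ℚ.toℚᵘ-injective (ℚᵘ.≃-trans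
  (ℚᵘ.*≡* (cong (ℤ._* ℤ.1ℤ) (trans (ℤ.pos-+ m n)
    (sym (cong₂ ℤ._+_ (ℤ.*-identityʳ (ℤ.+ m)) (ℤ.*-identityʳ (ℤ.+ n)))))))
  (ℚᵘ.≃-sym (ℚ.toℚᵘ-homo-+ (fromℕ m) (fromℕ n))))

fromℕ-* : ∀ m n → fromℕ (m ℕ.* n) ≡ fromℕ m ℚ.* fromℕ n
fromℕ-* m n = ℚ.toℚᵘ-injective (ℚᵘ.≃-trans
  (ℚᵘ.*≡* (cong (ℤ._* ℤ.1ℤ) (ℤ.pos-* m n)))
  (ℚᵘ.≃-sym (ℚ.toℚᵘ-homo-* (fromℕ m) (fromℕ n))))

fromℕ-mono-≤ : ∀ {m n} → m ℕ.≤ n → fromℕ m ℚ.≤ fromℕ n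
fromℕ-mono-≤ {m} {n} m≤n = ℚ.*≤* (subst₂ ℤ._≤_ (sym (ℤ.*-identityʳ (ℤ.+ m))) (sym (ℤ.*-identityʳ (ℤ.+ n))) (ℤ.+≤+ m≤n))

fromℕ-mono-< : ∀ {m n} → m ℕ.< n → fromℕ m ℚ.< fromℕ n
fromℕ-mono-< {m} {n} m<n = ℚ.*<* (subst₂ ℤ._<_ (sym (ℤ.*-identityʳ (ℤ.+ m))) (sym (ℤ.*-identityʳ (ℤ.+ n))) (ℤ.+<+ m<n))

denominator-* : ∀ d S → fromℕ (suc d) ℚ.* (ℤ.+ S ℚ./ suc d) ≡ fromℕ S
denominator-* d S = ℚ.toℚᵘ-injective (begin
  ℚ.toℚᵘ (fromℕ (suc d) ℚ.* (ℤ.+ S ℚ./ suc d))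
    ≈⟨ ℚ.toℚᵘ-homo-* (fromℕ (suc d)) (ℤ.+ S ℚ./ suc d) ⟩
  mkℚᵘ (ℤ.+ suc d) 0 ℚᵘ.* ℚ.toℚᵘ (ℤ.+ S ℚ./ suc d)
    ≈⟨ ℚᵘ.*-congˡ {mkℚᵘ (ℤ.+ suc d) 0} (ℚ.toℚᵘ-fromℚᵘ (mkℚᵘ (ℤ.+ S) d)) ⟩
  mkℚᵘ (ℤ.+ suc d) 0 ℚᵘ.* mkℚᵘ (ℤ.+ S) d
    ≈⟨ ℚᵘ.*≡* (trans (ℤ.*-identityʳ _) (trans (ℤ.*-comm (ℤ.+ suc d) (ℤ.+ S))
         (cong (λ k → ℤ.+ S ℤ.* (ℤ.+ suc k)) (sym (ℕ.+-identityʳ d))))) ⟩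
  mkℚᵘ (ℤ.+ S) 0 ∎)
  where open import Relation.Binary.Reasoning.Setoid ℚᵘ.≃-setoid

archimedean : ∀ ε → 0ℚ ℚ.< ε → ∃[ N ] ∀ n → N ℕ.≤ n → 1ℚ ℚ.≤ fromℕ (suc n) ℚ.* ε
archimedean (mkℚ (ℤ.+ zero) d c) (ℚ.*<* (ℤ.+<+ ()))
archimedean (mkℚ ℤ.-[1+ a ] d c) (ℚ.*<* ())
archimedean ε@(mkℚ (ℤ.+ suc a) d c) _ = d , λ n d≤n → begin
  1ℚ
    ≤⟨ fromℕ-mono-≤ (s≤s z≤n) ⟩
  fromℕ (suc a)
    ≡⟨ denominator-* d (suc a) ⟨
  fromℕ (suc d) ℚ.* (ℤ.+ suc a ℚ./ suc d)
    ≡⟨ cong (fromℕ (suc d) ℚ.*_) (ℚ.↥p/↧p≡p ε) ⟩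
  fromℕ (suc d) ℚ.* ε
    ≤⟨ ℚ.*-monoʳ-≤-nonNeg ε (fromℕ-mono-≤ (s≤s d≤n)) ⟩
  fromℕ (suc n) ℚ.* ε ∎
  where open ℚ.≤-Reasoning

0<½* : ∀ {ε} → 0ℚ ℚ.< ε → 0ℚ ℚ.< ε ℚ.* ½
0<½* {ε} 0<ε = subst (ℚ._< ε ℚ.* ½) (ℚ.*-zeroˡ ½) (ℚ.*-monoˡ-<-pos ½ 0<ε)

≤-of-close : ∀ p q ε → ℚ.∣ p ℚ.- q ∣ ℚ.< ε → p ℚ.≤ q ℚ.+ ε
≤-of-close p q ε close = begin
  p                        ≡⟨ solve 2 (λ a b → a := b :+ (a :- b)) refl p q ⟩
  q ℚ.+ (p ℚ.- q)          ≤⟨ ℚ.+-monoʳ-≤ q (≤-abs (p ℚ.- q)) ⟩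
  q ℚ.+ ℚ.∣ p ℚ.- q ∣      ≤⟨ ℚ.+-monoʳ-≤ q (ℚ.<⇒≤ close) ⟩
  q ℚ.+ ε ∎
  where
  open ℚ.≤-Reasoning
  open ℚ-Solver using (solve; _:+_; _:-_; _:=_)
  ≤-abs : ∀ p → p ℚ.≤ ℚ.∣ p ∣
  ≤-abs p with ℚ.≤-total 0ℚ p
  ... | inj₁ 0≤p = ℚ.≤-reflexive (sym (ℚ.0≤p⇒∣p∣≡p 0≤p))
  ... | inj₂ p≤0 = ℚ.≤-trans p≤0 (ℚ.0≤∣p∣ p)

-- A rational approximation of the inverse golden ratio

-- With M = 1 + M′ and c = M/D: c² + c ≤ 1, and eventually a ≤ 2 + c - 1/D.
-- The margin 1/D pays for the drift of the weights and for the unit steps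
-- between side items.
Calibrated : (ℕ → ℚ) → Set
Calibrated a = ∃[ D′ ] ∃[ M′ ] ∃[ Δ ] let D = suc D′ in
  D ℕ.* D ≡ suc M′ ℕ.* suc M′ ℕ.+ suc M′ ℕ.* D ℕ.+ Δ ×
  ∃[ N ] ∀ k → N ℕ.≤ k → fromℕ D ℚ.* a k ℚ.≤ fromℕ (D ℕ.+ (D ℕ.+ M′))

-- Completing the square: for D = 2n and M = S - n, the condition
-- M² + M D ≤ D² is S² ≤ 5 n². The other bound on S makes M positive.
golden-root : ∀ d S → let n = suc d ; D = n ℕ.+ n in
  S ℕ.* S ℕ.≤ 5 ℕ.* (n ℕ.* n) → 5 ℕ.* (n ℕ.* n) ℕ.< suc S ℕ.* suc S →
  ∃[ M′ ] ∃[ Δ ] suc n ℕ.+ M′ ≡ S × D ℕ.* D ≡ suc M′ ℕ.* suc M′ ℕ.+ suc M′ ℕ.* D ℕ.+ Δ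
golden-root d S lower upper with ℕ.m≤n⇒∃[o]m+o≡n S> | ℕ.m≤n⇒∃[o]m+o≡n lower
  where
  open ℕ.≤-Reasoning
  n = suc d
  quadruple : ∀ n → (n ℕ.+ n) ℕ.* (n ℕ.+ n) ≡ 4 ℕ.* (n ℕ.* n)
  quadruple = solve-∀
  S> : n ℕ.< S
  S> with suc S ℕ.≤? n ℕ.+ n
  ... | no ≰ = ℕ.≤-trans (s≤s (ℕ.m≤n+m n d)) (ℕ.s≤s⁻¹ (ℕ.≰⇒> ≰))
  ... | yes ≤ = contradiction (begin
    suc S ℕ.* suc S              ≤⟨ ℕ.*-mono-≤ ≤ ≤ ⟩
    (n ℕ.+ n) ℕ.* (n ℕ.+ n)      ≡⟨ quadruple n ⟩
    4 ℕ.* (n ℕ.* n)              ≤⟨ ℕ.*-monoˡ-≤ (n ℕ.* n) (ℕ.n≤1+n 4) ⟩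
    5 ℕ.* (n ℕ.* n) ∎) (ℕ.<⇒≱ upper)
... | M′ , refl | Δ , below = M′ , Δ , refl , ℕ.+-cancelʳ-≡ (suc d ℕ.* suc d) _ _
        (trans (quintuple (suc d)) (trans (sym below) (complete d M′ Δ)))
  where
  quintuple : ∀ n → (n ℕ.+ n) ℕ.* (n ℕ.+ n) ℕ.+ n ℕ.* n ≡ 5 ℕ.* (n ℕ.* n)
  quintuple = solve-∀
  complete : ∀ d M′ Δ → (suc (suc d) ℕ.+ M′) ℕ.* (suc (suc d) ℕ.+ M′) ℕ.+ Δ ≡
    suc M′ ℕ.* suc M′ ℕ.+ suc M′ ℕ.* (suc d ℕ.+ suc d) ℕ.+ Δ ℕ.+ suc d ℕ.* suc d
  complete = solve-∀

-- For S = n + M, the approximation S/n of √5 is 1 + M/n.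
root-fraction : ∀ d M′ S → suc (suc d) ℕ.+ M′ ≡ S →
  fromℕ (suc d) ℚ.* (ℤ.+ S ℚ./ suc d) ≡ 1ℚ ℚ.+ (fromℕ (suc d) ℚ.+ fromℕ M′)
root-fraction d M′ _ refl = trans (denominator-* d (suc (suc d) ℕ.+ M′))
  (trans (fromℕ-+ 1 (suc d ℕ.+ M′)) (cong (1ℚ ℚ.+_) (fromℕ-+ (suc d) M′)))

-- With n for δ and M = 1 + m, the equation n s = n + M turns (3 + s)/2 into
-- 2 + M/D for D = 2n. The gap ε/2 left below it is at least 1/D.
double-bound : ∀ δ a ε s m → 0ℚ ℚ.≤ δ → 1ℚ ℚ.≤ δ ℚ.* ε → a ℚ.+ ε ℚ.* ½ ℚ.≤ (3ℚ ℚ.+ s) ℚ.* ½ →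
  δ ℚ.* s ≡ 1ℚ ℚ.+ (δ ℚ.+ m) → (δ ℚ.+ δ) ℚ.* a ℚ.≤ δ ℚ.+ δ ℚ.+ (δ ℚ.+ δ ℚ.+ m)
double-bound δ a ε s m 0≤δ 1≤δε near δs = begin
  (δ ℚ.+ δ) ℚ.* a
    ≡⟨ solve 2 (λ d a → (d :+ d) :* a := (d :+ d) :* a :+ con 1ℚ :- con 1ℚ) refl δ a ⟩
  (δ ℚ.+ δ) ℚ.* a ℚ.+ 1ℚ ℚ.- 1ℚ
    ≤⟨ ℚ.+-monoˡ-≤ (ℚ.- 1ℚ) (ℚ.+-monoʳ-≤ ((δ ℚ.+ δ) ℚ.* a) 1≤δε) ⟩
  (δ ℚ.+ δ) ℚ.* a ℚ.+ δ ℚ.* ε ℚ.- 1ℚ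
    ≡⟨ solve 3 (λ d a e → (d :+ d) :* a :+ d :* e :- con 1ℚ := (d :+ d) :* (a :+ e :* con ½) :- con 1ℚ) refl δ a ε ⟩
  (δ ℚ.+ δ) ℚ.* (a ℚ.+ ε ℚ.* ½) ℚ.- 1ℚ
    ≤⟨ ℚ.+-monoˡ-≤ (ℚ.- 1ℚ) (ℚ.*-monoˡ-≤-nonNeg (δ ℚ.+ δ) {{ℚ.nonNegative (ℚ.+-mono-≤ 0≤δ 0≤δ)}} near) ⟩
  (δ ℚ.+ δ) ℚ.* ((3ℚ ℚ.+ s) ℚ.* ½) ℚ.- 1ℚ
    ≡⟨ solve 2 (λ d s → (d :+ d) :* ((con 3ℚ :+ s) :* con ½) :- con 1ℚ := d :+ d :+ d :+ d :* s :- con 1ℚ) refl δ s ⟩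
  δ ℚ.+ δ ℚ.+ δ ℚ.+ δ ℚ.* s ℚ.- 1ℚ
    ≡⟨ cong (λ z → δ ℚ.+ δ ℚ.+ δ ℚ.+ z ℚ.- 1ℚ) δs ⟩
  δ ℚ.+ δ ℚ.+ δ ℚ.+ (1ℚ ℚ.+ (δ ℚ.+ m)) ℚ.- 1ℚ
    ≡⟨ solve 2 (λ d m → d :+ d :+ d :+ (con 1ℚ :+ (d :+ m)) :- con 1ℚ := d :+ d :+ (d :+ d :+ m)) refl δ m ⟩
  δ ℚ.+ δ ℚ.+ (δ ℚ.+ δ ℚ.+ m) ∎
  where
  open ℚ.≤-Reasoning
  open ℚ-Solver using (solve; _:+_; _:*_; _:-_; _:=_; con)

slack : ∀ a b c ε → a ℚ.≤ b ℚ.+ ε ℚ.* ½ → b ℚ.+ ε ℚ.≤ c → a ℚ.+ ε ℚ.* ½ ℚ.≤ c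
slack a b c ε a≤ b≤ = begin
  a ℚ.+ ε ℚ.* ½                  ≤⟨ ℚ.+-monoˡ-≤ (ε ℚ.* ½) a≤ ⟩
  b ℚ.+ ε ℚ.* ½ ℚ.+ ε ℚ.* ½      ≡⟨ solve 2 (λ a e → a :+ e :* con ½ :+ e :* con ½ := a :+ e) refl b ε ⟩
  b ℚ.+ ε                        ≤⟨ b≤ ⟩
  c ∎
  where
  open ℚ.≤-Reasoning
  open ℚ-Solver using (solve; _:+_; _:*_; _:=_; con)

-- S is ⌊n √5⌋, known only through its two bounds.
calibrate-at : ∀ (a : ℕ → ℚ) ε {N} d S → let n = suc d in
  S ℕ.* S ℕ.≤ 5 ℕ.* (n ℕ.* n) → 5 ℕ.* (n ℕ.* n) ℕ.< suc S ℕ.* suc S →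
  (∀ k → N ℕ.≤ k → a k ℚ.≤ a d ℚ.+ ε ℚ.* ½) → a d ℚ.+ ε ℚ.≤ (3ℚ ℚ.+ ℤ.+ S ℚ./ n) ℚ.* ½ →
  1ℚ ℚ.≤ fromℕ n ℚ.* ε → Calibrated a
calibrate-at a ε {N} d S lower upper near below-d large with golden-root d S lower upper
... | M′ , Δ , S≡ , golden = d ℕ.+ n , M′ , Δ , golden , N , λ k N≤k → subst₂ ℚ._≤_
    (cong (ℚ._* a k) (sym (fromℕ-+ n n)))
    (sym (trans (fromℕ-+ (n ℕ.+ n) (n ℕ.+ n ℕ.+ M′))
      (cong₂ ℚ._+_ (fromℕ-+ n n)
        (trans (fromℕ-+ (n ℕ.+ n) M′) (cong (ℚ._+ fromℕ M′) (fromℕ-+ n n))))))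
    (double-bound (fromℕ n) (a k) ε (ℤ.+ S ℚ./ n) (fromℕ M′) (fromℕ-mono-≤ {0} {n} z≤n) large
      (slack (a k) (a d) ((3ℚ ℚ.+ ℤ.+ S ℚ./ n) ℚ.* ½) ε (near k N≤k) below-d)
      (root-fraction d M′ S S≡))
  where n = suc d

-- One index d serves three purposes: α has almost converged, it is ε below the
-- threshold there, and 1/(d + 1) ≤ ε.
calibrate : ∀ α → α Defs.< (fromℚ 3ℚ Defs.+ √ 5) Defs.* fromℚ ½ → Calibrated (seq α)
calibrate α (ε , 0<ε , N₁ , below) =
  calibrate-at (seq α) ε d (floorSqrt (5 ℕ.* (suc d ℕ.* suc d)))
    (floorSqrt-lower (5 ℕ.* (suc d ℕ.* suc d))) (floorSqrt-upper (5 ℕ.* (suc d ℕ.* suc d)))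
    (λ n N₂≤n → ≤-of-close (seq α n) (seq α d) (ε ℚ.* ½) (proj₂ close n d N₂≤n N₂≤d))
    (below d N₁≤d)
    (proj₂ large d (ℕ.m≤n⊔m (N₁ ⊔ N₂) (proj₁ large)))
  where
  close = cauchy α (ε ℚ.* ½) (0<½* 0<ε)
  large = archimedean ε 0<ε
  N₂ = proj₁ close
  d = N₁ ⊔ N₂ ⊔ proj₁ large
  N₁≤d = ℕ.≤-trans (ℕ.m≤m⊔n N₁ N₂) (ℕ.m≤m⊔n (N₁ ⊔ N₂) (proj₁ large))
  N₂≤d = ℕ.≤-trans (ℕ.m≤n⊔m N₁ N₂) (ℕ.m≤m⊔n (N₁ ⊔ N₂) (proj₁ large))

-- The instance

-- A name and a weight, so that one instance has unboundedly many items of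
-- every natural weight.
Item : Set
Item = ℕ × ℕ

item-≟ : DecidableEquality Item
item-≟ = ≡-dec ℕ._≟_ ℕ._≟_

total : List Item → ℕ
total xs = sum (map proj₂ xs)

Element : Set
Element = Item × ℕ

element-≟ : (x y : Element) → Dec (x ≡ y)
element-≟ = ≡-dec item-≟ ℕ._≟_

items : List Element → List Item
items = map proj₁

value : ∀ {n} → Vec Element n → Subset n → ℕ
value es S = total (deduplicate item-≟ (items (select es S)))

≤-pointwise : ∀ x y → (∀ k → seq x k ℚ.≤ seq y k) → x Defs.≤ y
≤-pointwise x y le (ε , 0<ε , N , gap) = ℚ.<-irrefl refl (begin-strict
  seq y N           ≡⟨ ℚ.+-identityʳ (seq y N) ⟨
  seq y N ℚ.+ 0ℚ    <⟨ ℚ.+-monoʳ-< (seq y N) 0<ε ⟩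
  seq y N ℚ.+ ε     ≤⟨ gap N ℕ.≤-refl ⟩
  seq x N           ≤⟨ le N ⟩
  seq y N ∎)
  where open ℚ.≤-Reasoning

game : Instance
game = record
  { 𝒰   = Item
  ; _≟_ = item-≟
  ; ν   = λ u → fromℚ (fromℕ (proj₂ u))
  ; ν≥0 = λ u → ≤-pointwise 0ℝ (fromℚ (fromℕ (proj₂ u))) λ _ → fromℕ-mono-≤ {0} {proj₂ u} z≤n
  }

seq-f : ∀ {n} (es : Vec Element n) S k → seq (f game es S) k ≡ fromℕ (value es S)
seq-f es S k = sums (deduplicate item-≟ (items (select es S)))
  where
  sums : ∀ xs → seq (foldr (λ x w → Instance.ν game x Defs.+ w) 0ℝ xs) k ≡ fromℕ (total xs)
  sums [] = refl
  sums (x ∷ xs) = trans (cong (fromℕ (proj₂ x) ℚ.+_) (sums xs)) (sym (fromℕ-+ (proj₂ x) (total xs)))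

-- Sets of arrived elements

module Arrivals where
  open import Data.Nat using (_≤_; _<_; _+_; _*_)
  open import Data.Nat.Properties

  module _ {A : Set} where

    select-⊆ : ∀ {n} (es : Vec A n) {S T} → S ⊆ T → ∀ {x} → x ∈ select es S → x ∈ select es T
    select-⊆ [] {[]} {[]} S⊆T ()
    select-⊆ (e ∷ es) {inside ∷ S} {inside ∷ T} S⊆T (here eq) = here eq
    select-⊆ (e ∷ es) {inside ∷ S} {inside ∷ T} S⊆T (there x∈) = there (select-⊆ es (Subset.drop-∷-⊆ S⊆T) x∈)
    select-⊆ (e ∷ es) {inside ∷ S} {outside ∷ T} S⊆T x∈ with S⊆T Vec.here
    ... | ()
    select-⊆ (e ∷ es) {outside ∷ S} {inside ∷ T} S⊆T x∈ = there (select-⊆ es (Subset.drop-∷-⊆ S⊆T) x∈)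
    select-⊆ (e ∷ es) {outside ∷ S} {outside ∷ T} S⊆T x∈ = select-⊆ es (Subset.drop-∷-⊆ S⊆T) x∈

    select-∈ : ∀ {n} (es : Vec A n) S {x} → x ∈ select es S → x ∈ᵛ es
    select-∈ [] [] ()
    select-∈ (e ∷ es) (inside ∷ S) (here eq) = here eq
    select-∈ (e ∷ es) (inside ∷ S) (there x∈) = there (select-∈ es S x∈)
    select-∈ (e ∷ es) (outside ∷ S) x∈ = there (select-∈ es S x∈)

    module _ (_≟_ : DecidableEquality A) where
      open DecMembership _≟_ using (_∈?_)

      arrived : List A → ∀ {n} → Vec A n → Subset n
      arrived xs = Vec.map (λ e → does (e ∈? xs))

      select-arrived⁺ : ∀ xs {n} (es : Vec A n) {x} → x ∈ xs → x ∈ᵛ es → x ∈ select es (arrived xs es)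
      select-arrived⁺ xs (e ∷ es) x∈xs x∈ with e ∈? xs | x∈
      ... | yes _   | here eq = here eq
      ... | yes _   | there x∈es = there (select-arrived⁺ xs es x∈xs x∈es)
      ... | no e∉xs | here refl = contradiction x∈xs e∉xs
      ... | no _    | there x∈es = select-arrived⁺ xs es x∈xs x∈es

      select-arrived⁻ : ∀ xs {n} (es : Vec A n) {x} → x ∈ select es (arrived xs es) → x ∈ xs
      select-arrived⁻ xs (e ∷ es) x∈ with e ∈? xs | x∈
      ... | yes e∈xs | here refl = e∈xs
      ... | yes _ | there x∈es = select-arrived⁻ xs es x∈es
      ... | no _  | x∈es = select-arrived⁻ xs es x∈es

  module _ {U : Set} where

    occupied⁺ : ∀ {n} (es : Vec (U × ℕ) n) S {x} → x ∈ select es S → 1 ≤ ∣ S ∩ part es (proj₂ x) ∣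
    occupied⁺ [] [] ()
    occupied⁺ ((u , i) ∷ es) (inside ∷ S) {x} (here refl) with i ℕ.≡ᵇ i | ≡⇒≡ᵇ i i refl
    ... | true | _ = s≤s z≤n
    occupied⁺ ((u , i) ∷ es) (inside ∷ S) {x} (there x∈) with i ℕ.≡ᵇ proj₂ x
    ... | true  = s≤s z≤n
    ... | false = occupied⁺ es S x∈
    occupied⁺ ((u , i) ∷ es) (outside ∷ S) x∈ = occupied⁺ es S x∈

    occupied⁻ : ∀ {n} (es : Vec (U × ℕ) n) S i → 1 ≤ ∣ S ∩ part es i ∣ → ∃[ x ] x ∈ select es S × proj₂ x ≡ i
    occupied⁻ [] [] i ()
    occupied⁻ (e ∷ es) (outside ∷ S) i 1≤ = occupied⁻ es S i 1≤
    occupied⁻ (e ∷ es) (inside ∷ S) i 1≤ with proj₂ e ℕ.≡ᵇ i in eq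
    ... | true  = e , here refl , ≡ᵇ⇒≡ (proj₂ e) i (subst T (sym eq) tt)
    ... | false with occupied⁻ es S i 1≤
    ...   | x , x∈ , eq = x , there x∈ , eq

    sole : ∀ {n} (es : Vec (U × ℕ) n) S → Independent es S →
           ∀ {x y} → x ∈ select es S → y ∈ select es S → proj₂ x ≡ proj₂ y → x ≡ y
    sole es S ind {x} x∈ y∈ same = go es S (ind (proj₂ x)) x∈ y∈ refl (sym same)
      where
      go : ∀ {n} (es : Vec (U × ℕ) n) S {i} → ∣ S ∩ part es i ∣ ≤ 1 →
           ∀ {x y} → x ∈ select es S → y ∈ select es S → proj₂ x ≡ i → proj₂ y ≡ i → x ≡ y
      go [] [] _ ()
      go (e ∷ es) (outside ∷ S) ≤1 x∈ y∈ xi yi = go es S ≤1 x∈ y∈ xi yi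
      go (e ∷ es) (inside ∷ S) ≤1 (here refl) (here refl) xi yi = refl
      go ((u , i) ∷ es) (inside ∷ S) ≤1 (here refl) (there y∈) refl yi with i ℕ.≡ᵇ i | ≡⇒≡ᵇ i i refl
      ... | true | _ = contradiction (subst (λ j → 1 ≤ ∣ S ∩ part es j ∣) yi (occupied⁺ es S y∈)) (<⇒≱ ≤1)
      go ((u , i) ∷ es) (inside ∷ S) ≤1 (there x∈) (here refl) xi refl with i ℕ.≡ᵇ i | ≡⇒≡ᵇ i i refl
      ... | true | _ = contradiction (subst (λ j → 1 ≤ ∣ S ∩ part es j ∣) xi (occupied⁺ es S x∈)) (<⇒≱ ≤1)
      go (e ∷ es) (inside ∷ S) {i} ≤1 (there x∈) (there y∈) xi yi with proj₂ e ℕ.≡ᵇ i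
      ... | true  = go es S (≤-trans (n≤1+n _) ≤1) x∈ y∈ xi yi
      ... | false = go es S ≤1 x∈ y∈ xi yi

    independent⁺ : ∀ {n} (es : Vec (U × ℕ) n) S → Unique es →
      (∀ {x y} → x ∈ select es S → y ∈ select es S → proj₂ x ≡ proj₂ y → x ≡ y) → Independent es S
    independent⁺ [] [] _ _ i = z≤n
    independent⁺ (e ∷ es) (outside ∷ S) (_ ∷ !es) inj i = independent⁺ es S !es inj i
    independent⁺ (e ∷ es) (inside ∷ S) (e∉ ∷ !es) inj i with proj₂ e ℕ.≡ᵇ i in eq
    ... | false = independent⁺ es S !es (λ x∈ y∈ → inj (there x∈) (there y∈)) i
    ... | true with ∣ S ∩ part es i ∣ in count
    ...   | zero  = s≤s z≤n
    ...   | suc c with occupied⁻ es S i (subst (1 ≤_) (sym count) (s≤s z≤n))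
    ...     | x , x∈ , xi = contradiction (inj (here refl) (there x∈) (trans (≡ᵇ⇒≡ (proj₂ e) i (subst T (sym eq) tt)) (sym xi)))
                                          (VecAll.lookup e∉ (select-∈ es S x∈))

  -- Optimal sets exist because there are finitely many sets and the values on
  -- the instance are natural numbers, which can be compared.
  argmax : ∀ n (P : Subset n → Set) → (∀ S → Dec (P S)) → (v : Subset n → ℕ) →
    (∀ S → ¬ P S) ⊎ (∃[ O ] P O × ∀ S → P S → v S ≤ v O)
  argmax zero P P? v with P? []
  ... | yes p = inj₂ ([] , p , λ { [] _ → ≤-refl })
  ... | no ¬p = inj₁ λ { [] → ¬p }
  argmax (suc n) P P? v with argmax n (P ∘ (inside ∷_)) (P? ∘ (inside ∷_)) (v ∘ (inside ∷_))
                           | argmax n (P ∘ (outside ∷_)) (P? ∘ (outside ∷_)) (v ∘ (outside ∷_))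
  ... | inj₁ ¬i | inj₁ ¬o = inj₁ λ { (inside ∷ S) → ¬i S ; (outside ∷ S) → ¬o S }
  ... | inj₂ (O , p , max) | inj₁ ¬o = inj₂ (_ , p , λ { (inside ∷ S) → max S ; (outside ∷ S) q → contradiction q (¬o S) })
  ... | inj₁ ¬i | inj₂ (O , p , max) = inj₂ (_ , p , λ { (inside ∷ S) q → contradiction q (¬i S) ; (outside ∷ S) → max S })
  ... | inj₂ (O , p , max) | inj₂ (O′ , p′ , max′) with ≤-total (v (inside ∷ O)) (v (outside ∷ O′))
  ...   | inj₁ ≤ = inj₂ (_ , p′ , λ { (inside ∷ S) q → ≤-trans (max S q) ≤ ; (outside ∷ S) → max′ S })
  ...   | inj₂ ≥ = inj₂ (_ , p , λ { (inside ∷ S) → max S ; (outside ∷ S) q → ≤-trans (max′ S q) ≥ })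

  total-++ : ∀ xs y ys → total (xs ++ y ∷ ys) ≡ proj₂ y + total (xs ++ ys)
  total-++ [] y ys = refl
  total-++ (x ∷ xs) y ys rewrite total-++ xs y ys = begin
    proj₂ x + (proj₂ y + t) ≡⟨ sym (+-assoc (proj₂ x) (proj₂ y) t) ⟩
    proj₂ x + proj₂ y + t   ≡⟨ cong (_+ t) (+-comm (proj₂ x) (proj₂ y)) ⟩
    proj₂ y + proj₂ x + t   ≡⟨ +-assoc (proj₂ y) (proj₂ x) t ⟩
    proj₂ y + (proj₂ x + t) ∎
    where
    open ≡-Reasoning
    t = total (xs ++ ys)

  total-mono : ∀ {xs ys} → UniqueList xs → (∀ {x} → x ∈ xs → x ∈ ys) → total xs ≤ total ys
  total-mono [] _ = z≤n
  total-mono {x ∷ xs} (x∉ ∷ !xs) xs⊆ with ∈-∃++ (xs⊆ (here refl))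
  ... | as , bs , refl = subst (proj₂ x + total xs ≤_) (sym (total-++ as x bs))
    (+-monoʳ-≤ (proj₂ x) (total-mono !xs λ y∈ → skip y∈ (∈-++⁻ as (xs⊆ (there y∈)))))
    where
    skip : ∀ {y} → y ∈ xs → y ∈ as ⊎ y ∈ x ∷ bs → y ∈ as ++ bs
    skip y∈ (inj₁ y∈as) = ∈-++⁺ˡ y∈as
    skip y∈ (inj₂ (here refl)) = contradiction refl (All.lookup x∉ y∈)
    skip y∈ (inj₂ (there y∈bs)) = ∈-++⁺ʳ as y∈bs

  Apart : Element → Element → Set
  Apart x y = proj₁ x ≢ proj₁ y × proj₂ x ≢ proj₂ y

  apart-injective : ∀ {os} → AllPairs Apart os → ∀ {x y} → x ∈ os → y ∈ os → proj₂ x ≡ proj₂ y → x ≡ y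
  apart-injective (o# ∷ #os) (here refl) (here refl) eq = refl
  apart-injective (o# ∷ #os) (here refl) (there y∈) eq = contradiction eq (proj₂ (All.lookup o# y∈))
  apart-injective (o# ∷ #os) (there x∈) (here refl) eq = contradiction (sym eq) (proj₂ (All.lookup o# x∈))
  apart-injective (o# ∷ #os) (there x∈) (there y∈) eq = apart-injective #os x∈ y∈ eq

  transversal : ∀ {n} (es : Vec Element n) os → Unique es → AllPairs Apart os → (∀ {x} → x ∈ os → x ∈ᵛ es) →
    ∃[ S ] Independent es S × total (items os) ≤ value es S
  transversal es os !es #os os⊆ = S ,
    independent⁺ es S !es (λ x∈ y∈ → apart-injective #os (select-arrived⁻ element-≟ os es x∈) (select-arrived⁻ element-≟ os es y∈)) ,
    total-mono (AllPairs.map⁺ (AllPairs.map proj₁ #os)) λ x∈ → ∈-deduplicate⁺ item-≟ (covered x∈)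
    where
    S = arrived element-≟ os es
    covered : ∀ {x} → x ∈ items os → x ∈ items (select es S)
    covered x∈ with ∈-map⁻ proj₁ x∈
    ... | o , o∈ , refl = ∈-map⁺ proj₁ (select-arrived⁺ element-≟ os es o∈ (os⊆ o∈))

  value-≤ : ∀ {n} (es : Vec Element n) S {G} → (∀ {x} → x ∈ select es S → proj₁ x ∈ G) → value es S ≤ total G
  value-≤ es S {G} confined = total-mono (deduplicate-! item-≟ _) λ x∈ → bound (∈-deduplicate⁻ item-≟ _ x∈)
    where
    bound : ∀ {x} → x ∈ items (select es S) → x ∈ G
    bound x∈ with ∈-map⁻ proj₁ x∈
    ... | o , o∈ , refl = confined o∈

open Arrivals

-- The weights of a round

module Arithmetic where
  open import Data.Nat using (_≤_; _<_; _+_; _*_)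
  open import Data.Nat.Properties

  -- A strict inequality p > q proved by one polynomial identity, given a
  -- combination s ≡ s′ of the available equations.
  excess : ∀ {p q s s′ n} → 0 < n → s ≡ s′ → p + s ≡ q + n + s′ → q < p
  excess {p} {q} {s} {n = n} 0<n refl eq = subst (q <_) (sym (+-cancelʳ-≡ s p (q + n) eq)) (m<m+n q 0<n)

  infixl 6 _⊕_
  _⊕_ : ∀ {a b c d} → a ≡ b → c ≡ d → a + c ≡ b + d
  _⊕_ = cong₂ _+_

  infixr 6.5 _⊛_
  _⊛_ : ∀ c {a b} → a ≡ b → c * a ≡ c * b
  c ⊛ eq = cong (c *_) eq

  module Accounts (D M′ Δ : ℕ) (golden : D * D ≡ suc M′ * suc M′ + suc M′ * D + Δ) where
    M = suc M′
    B = D + M′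
    K = suc (D + D)

    M≤D : M ≤ D
    M≤D with M ≤? D
    ... | yes p = p
    ... | no ¬p = ⊥-elim (<⇒≱ (*-mono-< q q) (subst (M * M ≤_) (sym golden) (≤-trans (m≤m+n (M * M) (M * D)) (m≤m+n _ Δ))))
      where q = ≰⇒> ¬p

    -- In round k put e = 2ᵏ and n′ = K - k - 2. The main item weighs D e (2 + n′),
    -- the cap on side items is M e n′, b is the weight of the side items held from
    -- earlier rounds and ℓ that of the lost elements. Summing the weights over the
    -- earlier rounds gives ℓ = D (e (4 + n′) - (K + 2)), and summing the caps gives
    -- b ≤ M (e (2 + n′) - K), both stated here without subtraction. The first
    -- assumption is k + (K - k) ≤ 2ᵏ (K - k).
    module _ {e n′ b ℓ : ℕ} (K≤ : K ≤ e * (2 + n′))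
      (lost : ℓ + D * (K + 2) ≡ D * e * (4 + n′))
      (extras : b + M * K ≤ M * e * (2 + n′)) where

      -- The two sides are (B/D) weight(G) and weight(L), both times D, after the
      -- lost twin and a side item at the cap have joined L. Eliminating by means
      -- of the assumptions, with slacks d, κ and σ, leaves a positive difference.
      reject-all : B * (D * e * (2 + n′) + b) < D * (M * e * n′ + (D * e * (2 + n′) + ℓ))
      reject-all with m≤n⇒∃[o]m+o≡n M≤D | m≤n⇒∃[o]m+o≡n K≤ | m≤n⇒∃[o]m+o≡n extras
      ... | d , M+d≡D | κ , K+κ≡ | σ , b+σ≡ =
        excess {n = D + ((D + M + Δ) * κ + 2 * D * e * d + B * σ)}
          (≤-trans (s≤s z≤n) (≤-trans M≤D (m≤m+n D _)))
          (D ⊛ sym lost ⊕ B ⊛ b+σ≡ ⊕ (2 * D * D + D * M) ⊛ K+κ≡ ⊕ B * (D + M) ⊛ sym K+κ≡ ⊕ κ ⊛ sym golden ⊕ 2 * D * e ⊛ M+d≡D)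
          (identity D M′ Δ e n′ b ℓ d κ σ)
        where
        identity : ∀ D M′ Δ e n′ b ℓ d κ σ →
          D * (suc M′ * e * n′ + (D * e * (2 + n′) + ℓ))
          + (D * (D * e * (4 + n′)) + (D + M′) * (b + suc M′ * suc (D + D) + σ) + (2 * D * D + D * suc M′) * (suc (D + D) + κ)
             + (D + M′) * (D + suc M′) * (e * (2 + n′)) + κ * (suc M′ * suc M′ + suc M′ * D + Δ) + 2 * D * e * (suc M′ + d))
          ≡ (D + M′) * (D * e * (2 + n′) + b)
          + (D + ((D + suc M′ + Δ) * κ + 2 * D * e * d + (D + M′) * σ))
          + (D * (ℓ + D * (suc (D + D) + 2)) + (D + M′) * (suc M′ * e * (2 + n′)) + (2 * D * D + D * suc M′) * (e * (2 + n′))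
             + (D + M′) * (D + suc M′) * (suc (D + D) + κ) + κ * (D * D) + 2 * D * e * D)
        identity = solve-∀

      -- Here a side item of weight 1 + j was accepted after one of weight j was
      -- rejected. As B ≥ D, the worst case is an item accepted at the cap; ρ is
      -- the distance to the cap.
      reject-next : ∀ {j} → suc j ≤ M * e * n′ →
        B * (D * e * (2 + n′) + (suc j + b)) < D * (D * (2 * e) * (1 + n′) + (j + ℓ))
      reject-next {j} j< with m≤n⇒∃[o]m+o≡n K≤ | m≤n⇒∃[o]m+o≡n extras | m≤n⇒∃[o]m+o≡n j<
      ... | κ , K+κ≡ | σ , b+σ≡ | ρ , j+ρ≡ =
        excess {n = M * K + ((2 * Δ + D + 2 * M) * κ + Δ * K + B * σ + 2 * M′ * M * e + M′ * ρ)}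
          (s≤s z≤n)
          (D ⊛ sym lost ⊕ B ⊛ b+σ≡ ⊕ 3 * D * D ⊛ K+κ≡ ⊕ (B * (D + M) + M′ * M) ⊛ sym K+κ≡
            ⊕ (2 * κ + K) ⊛ sym golden ⊕ M′ ⊛ j+ρ≡)
          (identity D M′ Δ e n′ b ℓ j κ σ ρ)
        where
        identity : ∀ D M′ Δ e n′ b ℓ j κ σ ρ →
          D * (D * (2 * e) * (1 + n′) + (j + ℓ))
          + (D * (D * e * (4 + n′)) + (D + M′) * (b + suc M′ * suc (D + D) + σ) + 3 * D * D * (suc (D + D) + κ)
             + ((D + M′) * (D + suc M′) + M′ * suc M′) * (e * (2 + n′)) + (2 * κ + suc (D + D)) * (suc M′ * suc M′ + suc M′ * D + Δ) + M′ * (suc j + ρ))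
          ≡ (D + M′) * (D * e * (2 + n′) + (suc j + b))
          + (suc M′ * suc (D + D) + ((2 * Δ + D + 2 * suc M′) * κ + Δ * suc (D + D) + (D + M′) * σ + 2 * M′ * suc M′ * e + M′ * ρ))
          + (D * (ℓ + D * (suc (D + D) + 2)) + (D + M′) * (suc M′ * e * (2 + n′)) + 3 * D * D * (e * (2 + n′))
             + ((D + M′) * (D + suc M′) + M′ * suc M′) * (suc (D + D) + κ) + (2 * κ + suc (D + D)) * (D * D) + M′ * (suc M′ * e * n′))
        identity = solve-∀

open Arithmetic

-- The adversary

module Game where
  open import Data.Nat using (_≤_; _<_; _+_; _*_)
  open import Data.Nat.Properties

  ∉⇒All : ∀ {A : Set} {n} {x : A} {xs : Vec A n} → ¬ x ∈ᵛ xs → VecAll.All (x ≢_) xs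
  ∉⇒All {xs = []} _ = VecAll.[]
  ∉⇒All {xs = y ∷ xs} x∉ = (λ { refl → x∉ (here refl) }) VecAll.∷ ∉⇒All (x∉ ∘ there)

  -- Names and parts of arrived elements are below n, so n itself is a fresh
  -- name and a fresh part for the next arrival.
  record Legal {n} (es : Vec Element n) : Set where
    field
      unique  : Unique es
      id<     : ∀ {x} → x ∈ᵛ es → proj₁ (proj₁ x) < n
      part<   : ∀ {x} → x ∈ᵛ es → proj₂ x < n

  open Legal

  arrive : ∀ {n} {es : Vec Element n} e → Legal es → proj₁ (proj₁ e) ≤ n → proj₂ e ≤ n →
           proj₁ (proj₁ e) ≡ n ⊎ proj₂ e ≡ n → Legal (e ∷ es)
  arrive {n} {es} e leg id≤ part≤ fresh = record
    { unique = ∉⇒All (λ e∈ → [ <⇒≢ (id< leg e∈) , <⇒≢ (part< leg e∈) ]′ fresh) ∷ unique leg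
    ; id<    = λ { (here refl) → s≤s id≤ ; (there x∈) → m≤n⇒m≤1+n (id< leg x∈) }
    ; part<  = λ { (here refl) → s≤s part≤ ; (there x∈) → m≤n⇒m≤1+n (part< leg x∈) }
    }

  AllPairs-resp-⊑ : ∀ {A : Set} {R : A → A → Set} {xs ys} → xs ⊑ ys → AllPairs R ys → AllPairs R xs
  AllPairs-resp-⊑ [] [] = []
  AllPairs-resp-⊑ (_ ∷ʳ xs⊑) (_ ∷ r) = AllPairs-resp-⊑ xs⊑ r
  AllPairs-resp-⊑ (refl ∷ xs⊑) (a ∷ r) = All-resp-⊆ xs⊑ a ∷ AllPairs-resp-⊑ xs⊑ r

  total-items-++ : ∀ R L → total (items (R ++ L)) ≡ total (items R) + total (items L)
  total-items-++ [] L = refl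
  total-items-++ (r ∷ R) L = trans (cong (proj₂ (proj₁ r) +_) (total-items-++ R L)) (sym (+-assoc (proj₂ (proj₁ r)) _ _))

  module Adversary (A : OnlineAlgorithm) where

    kept : ∀ {n} → Vec Element n → List Element
    kept es = select es (run (policy A) game es)

    kept-∷ : ∀ {n} (e : Element) (es : Vec Element n) → Unique (e ∷ es) →
             ∀ {x} → x ∈ kept (e ∷ es) → x ≡ e ⊎ x ∈ kept es
    kept-∷ e es !es x∈ with select-⊆ (e ∷ es) (irrevocable A game e es !es) x∈
    ... | here eq = inj₁ eq
    ... | there x∈′ = inj₂ x∈′

    kept? : ∀ {n} (es : Vec Element n) x → Dec (x ∈ kept es)
    kept? es x = DecMembership._∈?_ element-≟ x (kept es)

    -- G is u ∷ E, with main item u and side items E. The field holds is an upper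
    -- bound: the policy may have discarded more. The main item is confined to the
    -- parts in Q, while a side item may be held in any part.
    record Position {n} (es : Vec Element n) (u : Item) (Q : List ℕ) (E : List Item) (L : List Element) : Set where
      field
        legal    : Legal es
        holds    : ∀ {x} → x ∈ kept es → (proj₁ x ≡ u × proj₂ x ∈ Q) ⊎ proj₁ x ∈ E
        ids      : ∀ {g} → g ∈ u ∷ E → proj₁ g < n
        distinct : UniqueList (u ∷ E)
        lost⊆    : ∀ {x} → x ∈ L → x ∈ᵛ es
        lost#    : AllPairs Apart L
        lost∉    : ∀ {x} → x ∈ L → proj₁ x ∉ u ∷ E

    open Position

    forget : ∀ {n} {es : Vec Element n} {u Q E L L′} → L′ ⊑ L → Position es u Q E L → Position es u Q E L′
    forget L′⊑L P = record
      { legal = legal P ; holds = holds P ; ids = ids P ; distinct = distinct P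
      ; lost⊆ = λ x∈ → lost⊆ P (Sublist.lookup L′⊑L x∈)
      ; lost# = AllPairs-resp-⊑ L′⊑L (lost# P)
      ; lost∉ = λ x∈ → lost∉ P (Sublist.lookup L′⊑L x∈)
      }

    lose : ∀ {n} {es : Vec Element n} {u Q E L x} → Position es u Q E L →
           x ∈ᵛ es → All (Apart x) L → proj₁ x ∉ u ∷ E → Position es u Q E (x ∷ L)
    lose P x∈ x# x∉ = record
      { legal = legal P ; holds = holds P ; ids = ids P ; distinct = distinct P
      ; lost⊆ = λ { (here refl) → x∈ ; (there y∈) → lost⊆ P y∈ }
      ; lost# = x# ∷ lost# P
      ; lost∉ = λ { (here refl) → x∉ ; (there y∈) → lost∉ P y∈ }
      }

    new-∉ : ∀ {n w} {G : List Item} → (∀ {g} → g ∈ G → proj₁ g < n) → (n , w) ∉ G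
    new-∉ below n∈ = <-irrefl refl (below n∈)

    -- The policy may take the copy, keep the old element, or both.
    copy : ∀ {n} {es : Vec Element n} {u Q E L} → Position es u Q E L → Position ((u , n) ∷ es) u (n ∷ Q) E L
    copy {n} {es} {u} {Q} {E} P = record
      { legal = leg
      ; holds = λ x∈ → held (kept-∷ _ es (unique leg) x∈)
      ; ids = λ g∈ → m≤n⇒m≤1+n (ids P g∈) ; distinct = distinct P
      ; lost⊆ = λ x∈ → there (lost⊆ P x∈) ; lost# = lost# P ; lost∉ = lost∉ P
      }
      where
      leg = arrive (u , n) (legal P) (<⇒≤ (ids P (here refl))) ≤-refl (inj₂ refl)
      held : ∀ {x} → x ≡ (u , n) ⊎ x ∈ kept es → (proj₁ x ≡ u × proj₂ x ∈ n ∷ Q) ⊎ proj₁ x ∈ E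
      held (inj₁ refl) = inj₁ (refl , here refl)
      held (inj₂ x∈) = Sum.map₁ (map₂ there) (holds P x∈)

    module _ {n} {es : Vec Element n} {u Q E L} (w : ℕ) {i} (i≤n : i ≤ n) (P : Position es u Q E L) where
      private
        e : Element
        e = (n , w) , i

      arrives : Legal (e ∷ es)
      arrives = arrive e (legal P) ≤-refl i≤n (inj₁ refl)

      new-apart : All ((_≢ i) ∘ proj₂) L → All (Apart e) L
      new-apart off = All.tabulate λ x∈ →
        (λ { refl → <-irrefl refl (id< (legal P) (lost⊆ P x∈)) }) , (λ i≡ → All.lookup off x∈ (sym i≡))

      ignore : e ∉ kept (e ∷ es) → Position (e ∷ es) u Q E L
      ignore e∉ = record
        { legal = arrives
        ; holds = λ x∈ → [ (λ { refl → contradiction x∈ e∉ }) , holds P ]′ (kept-∷ e es (unique arrives) x∈)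
        ; ids = λ g∈ → m≤n⇒m≤1+n (ids P g∈) ; distinct = distinct P
        ; lost⊆ = λ x∈ → there (lost⊆ P x∈) ; lost# = lost# P ; lost∉ = lost∉ P
        }

      reject : e ∉ kept (e ∷ es) → All ((_≢ i) ∘ proj₂) L → Position (e ∷ es) u Q E (e ∷ L)
      reject e∉ off = lose (ignore e∉) (here refl) (new-apart off) (new-∉ (ids P))

      alone : e ∈ kept (e ∷ es) → ∀ {x} → x ∈ kept (e ∷ es) → proj₂ x ≡ i → x ≡ e
      alone e∈ x∈ eq = sole (e ∷ es) (run (policy A) game (e ∷ es)) (independent A game (e ∷ es) (unique arrives)) x∈ e∈ eq

    -- The part p was the only place of the old main item, and now it is taken.
    supersede : ∀ {n} {es : Vec Element n} {u p E L} w (p≤n : p ≤ n) → Position es u (p ∷ []) E L →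
                ((n , w) , p) ∈ kept (((n , w) , p) ∷ es) → Position (((n , w) , p) ∷ es) (n , w) (p ∷ []) E L
    supersede {n} {es} {u} {p} {E} w p≤n P e∈ = record
      { legal = leg
      ; holds = λ x∈ → held x∈ (kept-∷ e es (unique leg) x∈)
      ; ids = λ { (here refl) → ≤-refl ; (there g∈) → m≤n⇒m≤1+n (ids P (there g∈)) }
      ; distinct = All.tabulate (λ g∈ → λ { refl → <-irrefl refl (ids P (there g∈)) }) ∷ AllPairs.tail (distinct P)
      ; lost⊆ = λ x∈ → there (lost⊆ P x∈) ; lost# = lost# P
      ; lost∉ = λ { x∈ (here refl) → <-irrefl refl (id< (legal P) (lost⊆ P x∈)) ; x∈ (there g∈) → lost∉ P x∈ (there g∈) }
      }
      where
      e = (n , w) , p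
      leg = arrives w p≤n P
      held : ∀ {x} → x ∈ kept (e ∷ es) → x ≡ e ⊎ x ∈ kept es → (proj₁ x ≡ (n , w) × proj₂ x ∈ p ∷ []) ⊎ proj₁ x ∈ E
      held x∈ (inj₁ refl) = inj₁ (refl , here refl)
      held x∈ (inj₂ x∈′) with holds P x∈′
      ... | inj₂ g∈ = inj₂ g∈
      ... | inj₁ (_ , here p≡) with alone w p≤n P e∈ x∈ p≡
      ...   | refl = inj₁ (refl , here refl)

    -- An accepted side item drives the main item out of its part.
    cede : ∀ {n} {es : Vec Element n} {u q Q E L} w (q≤n : q ≤ n) → Position es u (q ∷ Q) E L →
           ((n , w) , q) ∈ kept (((n , w) , q) ∷ es) → Position (((n , w) , q) ∷ es) u Q ((n , w) ∷ E) L
    cede {n} {es} {u} {q} {Q} {E} w q≤n P e∈ = record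
      { legal = leg
      ; holds = λ x∈ → held x∈ (kept-∷ e es (unique leg) x∈)
      ; ids = λ { (here refl) → m≤n⇒m≤1+n (ids P (here refl)) ; (there (here refl)) → ≤-refl
                ; (there (there g∈)) → m≤n⇒m≤1+n (ids P (there g∈)) }
      ; distinct = ((λ { refl → <-irrefl refl (ids P (here refl)) }) ∷ AllPairs.head (distinct P))
                   ∷ All.tabulate (λ g∈ → λ { refl → <-irrefl refl (ids P (there g∈)) }) ∷ AllPairs.tail (distinct P)
      ; lost⊆ = λ x∈ → there (lost⊆ P x∈) ; lost# = lost# P
      ; lost∉ = λ { x∈ (here refl) → lost∉ P x∈ (here refl)
                  ; x∈ (there (here refl)) → <-irrefl refl (id< (legal P) (lost⊆ P x∈))
                  ; x∈ (there (there g∈)) → lost∉ P x∈ (there g∈) }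
      }
      where
      e = (n , w) , q
      leg = arrives w q≤n P
      held : ∀ {x} → x ∈ kept (e ∷ es) → x ≡ e ⊎ x ∈ kept es → (proj₁ x ≡ u × proj₂ x ∈ Q) ⊎ proj₁ x ∈ (n , w) ∷ E
      held x∈ (inj₁ refl) = inj₂ (here refl)
      held x∈ (inj₂ x∈′) with holds P x∈′
      ... | inj₂ g∈ = inj₂ (there g∈)
      ... | inj₁ (x≡u , there q∈) = inj₁ (x≡u , q∈)
      ... | inj₁ (_ , here q≡) with alone w q≤n P e∈ x∈ q≡
      ...   | refl = inj₂ (here refl)

    module Play (D M′ Δ : ℕ) (golden : D * D ≡ suc M′ * suc M′ + suc M′ * D + Δ)
      (competitive : ∀ {n} (es : Vec Element n) → Unique es → ∀ S → Independent es S →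
                     D * value es S ≤ (D + (D + M′)) * value es (run (policy A) game es)) where

      open Accounts D M′ Δ golden

      -- The items of xs are copied to fresh parts one by one; os is the set that
      -- the optimum is compared with, and grows with every copy.
      endgame : ∀ G xs {n} (es : Vec Element n) os → Legal es →
        (∀ {x} → x ∈ kept es → proj₁ x ∈ G) → (∀ {g} → g ∈ G → proj₁ g < n) →
        (∀ {x} → x ∈ xs → x ∈ G) → UniqueList xs →
        AllPairs Apart os → (∀ {x} → x ∈ os → x ∈ᵛ es) → (∀ {x} → x ∈ os → proj₁ x ∉ xs) →
        D * (total (items os) + total xs) ≤ (D + B) * total G
      endgame G [] es os leg confined ids _ _ #os os⊆ _ with transversal es os (unique leg) #os os⊆
      ... | S , ind , ≤S = begin
        D * (total (items os) + 0)               ≡⟨ cong (D *_) (+-identityʳ _) ⟩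
        D * total (items os)                     ≤⟨ *-monoʳ-≤ D ≤S ⟩
        D * value es S                           ≤⟨ competitive es (unique leg) S ind ⟩
        (D + B) * value es (run (policy A) game es) ≤⟨ *-monoʳ-≤ (D + B) (value-≤ es _ confined) ⟩
        (D + B) * total G ∎
        where open ≤-Reasoning
      endgame G (x ∷ xs) {n} es os leg confined ids xs⊆ (x∉ ∷ !xs) #os os⊆ os∉ =
        subst (λ z → D * z ≤ (D + B) * total G) (rearrange (proj₂ x) (total (items os)) (total xs))
          (endgame G xs (e ∷ es) (e ∷ os) leg′
            (λ y∈ → [ (λ { refl → xs⊆ (here refl) }) , confined ]′ (kept-∷ e es (unique leg′) y∈))
            (λ g∈ → m≤n⇒m≤1+n (ids g∈)) (λ y∈ → xs⊆ (there y∈)) !xs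
            (All.tabulate (λ y∈ → (λ { refl → os∉ y∈ (here refl) })
                                 , (λ { refl → <-irrefl refl (part< leg (os⊆ y∈)) })) ∷ #os)
            (λ { (here refl) → here refl ; (there y∈) → there (os⊆ y∈) })
            (λ { (here refl) y∈ → All.lookup x∉ y∈ refl ; (there o∈) y∈ → os∉ o∈ (there y∈) }))
        where
        e = x , n
        leg′ = arrive e leg (<⇒≤ (ids (xs⊆ (here refl)))) ≤-refl (inj₂ refl)
        rearrange : ∀ a b c → a + b + c ≡ b + (a + c)
        rearrange = solve-∀

      -- The weight of G is collected by both sides, which turns the ratio
      -- (D + B)/D into B/D.
      settle : ∀ {n} {es : Vec Element n} {u Q E L} → Position es u Q E L → D * total (items L) ≤ B * total (u ∷ E)
      settle {es = es} {u} {Q} {E} {L} P = +-cancelʳ-≤ (D * total G) _ _ (begin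
        D * total (items L) + D * total G ≡⟨ *-distribˡ-+ D (total (items L)) (total G) ⟨
        D * (total (items L) + total G)   ≤⟨ endgame G G es L (legal P)
                                               (λ x∈ → [ (λ { (refl , _) → here refl }) , there ]′ (holds P x∈))
                                               (ids P) id (distinct P) (lost# P) (lost⊆ P) (lost∉ P) ⟩
        (D + B) * total G                 ≡⟨ *-distribʳ-+ (total G) D B ⟩
        D * total G + B * total G         ≡⟨ +-comm (D * total G) (B * total G) ⟩
        B * total G + D * total G ∎)
        where
        open ≤-Reasoning
        G = u ∷ E

      -- The start of round k, for e = 2ᵏ and m = K - k - 2.
      record Stage (m e : ℕ) {n} (es : Vec Element n) (u : Item) (p : ℕ) (E : List Item) (L : List Element) : Set where
        field
          large  : K ≤ e * (2 + m)
          lost   : total (items L) + D * (K + 2) ≡ D * e * (4 + m)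
          extras : total E + M * K ≤ M * e * (2 + m)
          main   : proj₂ u ≡ D * e * (2 + m)
          placed : (u , p) ∈ᵛ es
          clear  : All ((_≢ p) ∘ proj₂) L
          position : Position es u (p ∷ []) E L

      -- A round after the twin c of the main item a was lost in p and the copy of a
      -- has arrived in q.
      module Round {m e : ℕ}
        (next : ∀ {m′} → m ≡ suc m′ → ∀ {n} {es : Vec Element n} {u p E L} → Stage m′ (2 * e) es u p E L → ⊥)
        {a c : Item} {p q : ℕ} {E : List Item} {L : List Element}
        (large : K ≤ e * (2 + m))
        (lost : total (items L) + D * (K + 2) ≡ D * e * (4 + m))
        (extras : total E + M * K ≤ M * e * (2 + m))
        (a-main : proj₂ a ≡ D * e * (2 + m))
        (c-main : proj₂ c ≡ D * e * (2 + m))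
        (clear : All ((_≢ p) ∘ proj₂) L)
        (fresh : All ((_≢ q) ∘ proj₂) ((c , p) ∷ L))
        where

        private
          p≢q : p ≢ q
          p≢q = All.head fresh

          ℓ = total (items L)

          x′ = D * (2 * e) * (1 + m)

        -- R consists of the last rejected side item, of weight j, and is empty for
        -- j = 0. Side items arrive until the cap is reached, in fuel steps. Only
        -- one of them can be in R since all of them arrive in q.
        chain : ∀ fuel j R {n} {es : Vec Element n} → j + fuel ≡ M * e * m → total (items R) ≡ j →
          All ((_≡ q) ∘ proj₂) R → (a , q) ∈ᵛ es → Position es a (q ∷ p ∷ []) E (R ++ (c , p) ∷ L) → ⊥

        -- The side item y has been accepted and the next main item arrives in p. The
        -- twin c has left the lost elements: in p it would compete with that item,
        -- which weighs at least as much.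
        contend : ∀ {j} R → suc j ≤ M * e * m → total (items R) ≡ j → All ((_≡ q) ∘ proj₂) R →
          ∀ {n} {es : Vec Element n} {y} → proj₂ y ≡ suc j → (a , q) ∈ᵛ es → p ≤ n →
          Position es a (p ∷ []) (y ∷ E) (R ++ L) → ⊥

        chain zero j R j≡ R≡ _ _ P = <⇒≱ (reject-all large lost extras) (subst₂ _≤_
          (cong (D *_) (trans (total-items-++ R ((c , p) ∷ L))
                              (cong₂ _+_ (trans R≡ (trans (sym (+-identityʳ j)) j≡)) (cong (_+ ℓ) c-main))))
          (cong (λ z → B * (z + total E)) a-main)
          (settle P))
        chain (suc fuel) j R {n} {es} j≡ R≡ R-at a∈ P with kept? (((n , suc j) , q) ∷ es) ((n , suc j) , q)
        ... | no  y∉ = chain fuel (suc j) (((n , suc j) , q) ∷ []) (trans (sym (+-suc j fuel)) j≡)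
                         (+-identityʳ (suc j)) (refl ∷ []) (there a∈)
                         (reject (suc j) (<⇒≤ (part< (legal P) a∈)) (forget (++⁺ˡ R ⊑-refl) P) y∉ fresh)
        ... | yes y∈ = contend R (subst (suc j ≤_) (trans (sym (+-suc j fuel)) j≡) (m≤m+n (suc j) fuel)) R≡ R-at
                         refl (there a∈) (m≤n⇒m≤1+n (<⇒≤ (part< (legal P) (lost⊆ P (∈-++⁺ʳ R (here refl))))))
                         (forget (++⁺ ⊑-refl ((c , p) ∷ʳ ⊑-refl)) (cede (suc j) (<⇒≤ (part< (legal P) a∈)) P y∈))

        contend {j} R j< R≡ R-at {n} {es} {y} y≡ a∈ p≤n P with kept? (((n , x′) , p) ∷ es) ((n , x′) , p)
        ... | no  t∉ = <⇒≱ (reject-next large lost extras j<) (subst₂ _≤_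
          (cong (λ z → D * (x′ + z)) (trans (total-items-++ R L) (cong (_+ ℓ) R≡)))
          (cong₂ (λ z w → B * (z + (w + total E))) a-main y≡)
          (settle (reject x′ p≤n P t∉ (All.++⁺ (All.map (λ at eq → p≢q (trans (sym eq) at)) R-at) clear))))
        ... | yes t∈ = promote refl
          where
          -- For m = 0 the cap is zero, which no accepted side item meets. Otherwise
          -- R is dropped, since the optimum now uses q for a.
          promote : ∀ {m₀} → m ≡ m₀ → ⊥
          promote {zero} refl = contradiction (subst (suc j ≤_) (*-zeroʳ (M * e)) j<) λ ()
          promote {suc m′} refl = next refl record
            { large  = ≤-trans large (subst₂ _≤_ (+-identityʳ _) (grow e m′) (+-monoʳ-≤ (e * (3 + m′)) z≤n))
            ; lost   = trans (cong (λ z → z + ℓ + D * (K + 2)) a-main) (trans (+-assoc (D * e * (3 + m′)) ℓ (D * (K + 2))) (trans (cong (D * e * (3 + m′) +_) lost) (double D e m′)))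
            ; extras = subst₂ _≤_ (cong (λ z → z + total E + M * K) (sym y≡)) (double′ M e m′)
                         (subst (_≤ M * e * suc m′ + M * e * (3 + m′)) (sym (+-assoc (suc j) (total E) (M * K))) (+-mono-≤ j< extras))
            ; main   = refl
            ; placed = here refl
            ; clear  = (p≢q ∘ sym) ∷ clear
            ; position = lose (forget (++⁺ˡ R ⊑-refl) (supersede x′ p≤n P t∈)) (there a∈)
                (All.zipWith id (All.tabulate (λ x∈ eq → lost∉ P (∈-++⁺ʳ R x∈) (here (sym eq))) , All.map (_∘ sym) (All.tail fresh)))
                λ { (here refl) → <-irrefl refl (ids P (here refl)) ; (there a∈E) → All.lookup (AllPairs.head (distinct P)) a∈E refl }
            }
            where
            grow : ∀ e m′ → e * (3 + m′) + e * (1 + m′) ≡ 2 * e * (2 + m′)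
            grow = solve-∀
            double : ∀ D e m′ → D * e * (3 + m′) + D * e * (5 + m′) ≡ D * (2 * e) * (4 + m′)
            double = solve-∀
            double′ : ∀ M e m′ → M * e * (1 + m′) + M * e * (3 + m′) ≡ M * (2 * e) * (2 + m′)
            double′ = solve-∀

      round : ∀ m e {n} {es : Vec Element n} {u p E L} → Stage m e es u p E L → ⊥
      round m e {n} {es} {u} {p} {E} {L} S = twin (kept? (v ∷ es) v)
        where
        open Stage S
        v = (n , proj₂ u) , p
        p≤n = <⇒≤ (part< (legal position) placed)

        next : ∀ {m′} → m ≡ suc m′ → ∀ {n} {es : Vec Element n} {u p E L} → Stage m′ (2 * e) es u p E L → ⊥
        next {m′} refl = round m′ (2 * e)

        contest : ∀ {a c n} {es : Vec Element n} → proj₂ a ≡ D * e * (2 + m) → proj₂ c ≡ D * e * (2 + m) →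
                  Position es a (p ∷ []) E ((c , p) ∷ L) → ⊥
        contest {a} {c} a≡ c≡ P = Round.chain next large lost extras a≡ c≡ clear
          (All.tabulate (λ x∈ eq → <-irrefl eq (part< (legal P) (lost⊆ P x∈))))
          (M * e * m) 0 [] refl refl [] (here refl) (copy P)

        -- In either case the twin that is not held joins the lost elements.
        twin : Dec (v ∈ kept (v ∷ es)) → ⊥
        twin (yes v∈) = contest main main (lose (supersede (proj₂ u) p≤n position v∈) (there placed)
          (All.zipWith id (All.tabulate (λ x∈ eq → lost∉ position x∈ (here (sym eq))) , All.map (_∘ sym) clear))
          λ { (here refl) → <-irrefl refl (ids position (here refl))
            ; (there u∈) → All.lookup (AllPairs.head (distinct position)) u∈ refl })
        twin (no v∉) = contest main main (reject (proj₂ u) p≤n position v∉ clear)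

      lower-bound : ⊥
      lower-bound with m≤n⇒∃[o]m+o≡n (s≤s (≤-trans (s≤s z≤n) (≤-trans M≤D (m≤m+n D D))))
      ... | m , 2+m≡K = round m 1 {es = e₀ ∷ []} {L = []} record
        { large  = ≤-reflexive (trans (sym 2+m≡K) (sym (*-identityˡ (2 + m))))
        ; lost   = cong₂ _*_ (sym (*-identityʳ D)) (trans (cong (_+ 2) (sym 2+m≡K)) (+-comm (2 + m) 2))
        ; extras = ≤-reflexive (cong₂ _*_ (sym (*-identityʳ M)) (sym 2+m≡K))
        ; main   = refl
        ; placed = here refl
        ; clear  = []
        ; position = record
          { legal = leg
          ; holds = λ x∈ → [ (λ { refl → inj₁ (refl , here refl) }) , (λ ()) ]′ (kept-∷ e₀ [] (unique leg) x∈)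
          ; ids = λ { (here refl) → s≤s z≤n ; (there ()) }
          ; distinct = [] ∷ []
          ; lost⊆ = λ () ; lost# = [] ; lost∉ = λ ()
          }
        }
        where
        e₀ : Element
        e₀ = (0 , D * 1 * (2 + m)) , 0
        leg : Legal (e₀ ∷ [])
        leg = arrive e₀ (record { unique = [] ; id< = λ () ; part< = λ () }) z≤n z≤n (inj₁ refl)

open Game

-- From real to natural numbers

module _ {α r : ℝ} (0<α : 0ℝ Defs.< α) (α⁻¹<r : α ⁻¹⟨ 0<α ⟩ Defs.< r) {p Q : ℕ}
  (α≤ : ∃[ N ] ∀ n → N ℕ.≤ n → fromℕ (suc p) ℚ.* seq α n ℚ.≤ fromℕ Q) where

  private P = suc p

  -- The gap between 1/α and r, multiplied by the optimal value, which is positive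
  -- by the strict inequality, makes the difference of the real numbers positive.
  beaten : ∀ x y {a o} → (∀ k → seq x k ≡ fromℕ a) → (∀ k → seq y k ≡ fromℕ o) →
           Q ℕ.* a ℕ.< P ℕ.* o → x Defs.< r Defs.* y
  beaten x y {a} {o} x≡ y≡ lt = ε ℚ.* fromℕ o , 0<gap , N ⊔ N₁ ⊔ N₂ , bound
    where
    open ℚ.≤-Reasoning
    open ℚ-Solver using (solve; _:+_; _:*_; _:=_)
    δ = proj₁ 0<α
    0<δ = proj₁ (proj₂ 0<α)
    N = proj₁ (proj₂ (proj₂ 0<α))
    δ≤ = proj₂ (proj₂ (proj₂ 0<α))
    ε = proj₁ α⁻¹<r
    0<ε = proj₁ (proj₂ α⁻¹<r)
    N₁ = proj₁ (proj₂ (proj₂ α⁻¹<r))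
    N₂ = proj₁ α≤
    0<o : 0 ℕ.< o
    0<o = positive o lt
      where
      positive : ∀ o → Q ℕ.* a ℕ.< P ℕ.* o → 0 ℕ.< o
      positive zero lt = contradiction (subst (Q ℕ.* a ℕ.<_) (ℕ.*-zeroʳ P) lt) λ ()
      positive (suc o) _ = s≤s z≤n
    0<gap : 0ℚ ℚ.< ε ℚ.* fromℕ o
    0<gap = subst (ℚ._< ε ℚ.* fromℕ o) (ℚ.*-zeroʳ ε) (ℚ.*-monoʳ-<-pos ε {{ℚ.positive 0<ε}} (fromℕ-mono-< 0<o))
    bound : ∀ k → N ⊔ N₁ ⊔ N₂ ℕ.≤ k → seq x k ℚ.+ ε ℚ.* fromℕ o ℚ.≤ seq r k ℚ.* seq y k
    bound k le = begin
      seq x k ℚ.+ ε ℚ.* fromℕ o                     ≡⟨ cong (ℚ._+ ε ℚ.* fromℕ o) (x≡ k) ⟩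
      fromℕ a ℚ.+ ε ℚ.* fromℕ o                     ≡⟨ cong (ℚ._+ ε ℚ.* fromℕ o) (ℚ.*-identityˡ (fromℕ a)) ⟨
      1ℚ ℚ.* fromℕ a ℚ.+ ε ℚ.* fromℕ o              ≡⟨ cong (λ z → z ℚ.* fromℕ a ℚ.+ ε ℚ.* fromℕ o) (recip-inverse δ 0<δ αₖ δ≤αₖ) ⟨
      αₖ ℚ.* ρ ℚ.* fromℕ a ℚ.+ ε ℚ.* fromℕ o        ≡⟨ solve 5 (λ α ρ a ε o → α :* ρ :* a :+ ε :* o := ρ :* (α :* a) :+ ε :* o) refl αₖ ρ (fromℕ a) ε (fromℕ o) ⟩
      ρ ℚ.* (αₖ ℚ.* fromℕ a) ℚ.+ ε ℚ.* fromℕ o      ≤⟨ ℚ.+-monoˡ-≤ (ε ℚ.* fromℕ o) (ℚ.*-monoˡ-≤-nonNeg ρ {{ℚ.nonNegative (ℚ.<⇒≤ (0<recip δ 0<δ αₖ))}} scaled) ⟩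
      ρ ℚ.* fromℕ o ℚ.+ ε ℚ.* fromℕ o               ≡⟨ ℚ.*-distribʳ-+ (fromℕ o) ρ ε ⟨
      (ρ ℚ.+ ε) ℚ.* fromℕ o                         ≤⟨ ℚ.*-monoʳ-≤-nonNeg (fromℕ o) (proj₂ (proj₂ (proj₂ α⁻¹<r)) k N₁≤) ⟩
      seq r k ℚ.* fromℕ o                           ≡⟨ cong (seq r k ℚ.*_) (y≡ k) ⟨
      seq r k ℚ.* seq y k ∎
      where
      N≤  = ℕ.m⊔n≤o⇒m≤o N N₁ (ℕ.m⊔n≤o⇒m≤o (N ⊔ N₁) N₂ le)
      N₁≤ = ℕ.m⊔n≤o⇒n≤o N N₁ (ℕ.m⊔n≤o⇒m≤o (N ⊔ N₁) N₂ le)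
      N₂≤ = ℕ.m⊔n≤o⇒n≤o (N ⊔ N₁) N₂ le
      αₖ = seq α k
      ρ = recip δ 0<δ αₖ
      δ≤αₖ : δ ℚ.≤ αₖ
      δ≤αₖ = subst (ℚ._≤ αₖ) (ℚ.+-identityˡ δ) (δ≤ k N≤)
      scaled : αₖ ℚ.* fromℕ a ℚ.≤ fromℕ o
      scaled = ℚ.*-cancelˡ-≤-pos (fromℕ P) (begin
        fromℕ P ℚ.* (αₖ ℚ.* fromℕ a)   ≡⟨ ℚ.*-assoc (fromℕ P) αₖ (fromℕ a) ⟨
        fromℕ P ℚ.* αₖ ℚ.* fromℕ a     ≤⟨ ℚ.*-monoʳ-≤-nonNeg (fromℕ a) (proj₂ α≤ k N₂≤) ⟩
        fromℕ Q ℚ.* fromℕ a            ≡⟨ fromℕ-* Q a ⟨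
        fromℕ (Q ℕ.* a)                ≤⟨ fromℕ-mono-≤ (ℕ.<⇒≤ lt) ⟩
        fromℕ (P ℕ.* o)                ≡⟨ fromℕ-* P o ⟩
        fromℕ P ℚ.* fromℕ o ∎)

  competitive-ℕ : ∀ A → HasCompetitiveRatio A r → ∀ {n} (es : Vec Element n) → Unique es → ∀ S → Independent es S →
    P ℕ.* value es S ℕ.≤ Q ℕ.* value es (run (policy A) game es)
  competitive-ℕ A comp {n} es !es S ind with argmax n (Independent es) (independent? es) (value es)
  ... | inj₁ none = contradiction ind (none S)
  ... | inj₂ (O , indO , max) with P ℕ.* value es S ℕ.≤? Q ℕ.* value es (run (policy A) game es)
  ...   | yes le = le
  ...   | no  ≰  = contradiction
            (beaten (f game es (run (policy A) game es)) (f game es O)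
              (seq-f es (run (policy A) game es)) (seq-f es O) (ℕ.<-≤-trans (ℕ.≰⇒> ≰) (ℕ.*-monoʳ-≤ P (max S ind))))
            (comp game es !es O (indO , optimal))
    where
    optimal : ∀ T → Independent es T → f game es T Defs.≤ f game es O
    optimal T indT = ≤-pointwise (f game es T) (f game es O) λ k →
      subst₂ ℚ._≤_ (sym (seq-f es T k)) (sym (seq-f es O k)) (fromℕ-mono-≤ (max T indT))

refute : ∀ α r (0<α : 0ℝ Defs.< α) → α ⁻¹⟨ 0<α ⟩ Defs.< r → ∀ A → HasCompetitiveRatio A r →
  ¬ Calibrated (seq α)
refute α r 0<α α⁻¹<r A comp (D′ , M′ , Δ , golden , α≤) =
  Adversary.Play.lower-bound A (suc D′) M′ Δ golden (competitive-ℕ {α} {r} 0<α α⁻¹<r α≤ A comp)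

open import Defs using (_<_; _+_; _*_)

theorem6p2 : (α : ℝ) (0<α : 0ℝ < α) → α < (fromℚ 3ℚ + √ 5) * fromℚ ½ →
    (A : OnlineAlgorithm) →
    ¬ (∃[ r ] (α ⁻¹⟨ 0<α ⟩ < r × HasCompetitiveRatio A r))
theorem6p2 α 0<α α<φ² A (r , α⁻¹<r , comp) = refute α r 0<α α⁻¹<r A comp (calibrate α α<φ²)
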